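{- There is a deterministic algorithm for graph reconstruction using a shortest path oracle whose query complexity is $$n^{1+O\left(\sqrt{(\log\log n+\log\Delta)/\log n}\right)},$$ where $\Delta$ is the maximum degree of $G$. Moreover, if $G$ has treewidth $\mathrm{tw}$, its query complexity is $O(\Delta(\Delta+\mathrm{tw}\log n)\,n\log^2 n)$.
   Context: Let $G=(V,E)$ be an unknown connected, unweighted, undirected simple graph with $|V|=n$. A shortest path oracle receives a pair $(u,v)\in V^2$ and returns some shortest path in $G$ between $u$ and $v$. In the reconstruction problem, an algorithm is given $V$, has access to the oracle, and must output $E$. The query complexity is the maximum number of oracle queries made. -}

module Defs where

open import Data.Bool.Base using (Bool; T)
open import Data.Fin.Base using (Fin)
open import Data.Fin.Subset using (Subset; _∈_; ∣_∣)
open import Data.List.Base using (List; head; last; length; tabulate)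
open import Data.List.Extrema.Nat using (max)
open import Data.List.Relation.Unary.All using (All)
open import Data.List.Relation.Unary.Linked using (Linked)
open import Data.List.Relation.Unary.Unique.Propositional using (Unique)
open import Data.Maybe.Base using (just)
open import Data.Nat.Base using (ℕ; zero; suc; _+_; _*_; _^_; _∸_; _≤_; NonZero)
open import Data.Product.Base using (Σ-syntax; ∃-syntax; _×_)
import Data.Vec.Base as Vec
open import Relation.Binary.Construct.Closure.ReflexiveTransitive using (Star)
open import Relation.Binary.PropositionalEquality using (_≡_)
open import Relation.Nullary.Negation.Core using (¬_)

-- A set of ordered pairs of vertices, given by its characteristic function.
EdgeSet : ℕ → Set
EdgeSet n = Fin n → Fin n → Bool

record Graph (n : ℕ) : Set where
  field
    edges  : EdgeSet n
    irrefl : ∀ u → ¬ T (edges u u)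
    sym    : ∀ u v → T (edges u v) → T (edges v u)

  Adj : Fin n → Fin n → Set
  Adj u v = T (edges u v)

  degree : Fin n → ℕ
  degree u = ∣ Vec.tabulate (edges u) ∣

  maxDegree : ℕ
  maxDegree = max 0 (tabulate degree)

  Connected : Set
  Connected = ∀ u v → Star Adj u v

  -- A path is the list of its vertices, both endpoints included.
  IsPath : Fin n → Fin n → List (Fin n) → Set
  IsPath u v p = head p ≡ just u × last p ≡ just v × Linked Adj p × Unique p

  IsShortestPath : Fin n → Fin n → List (Fin n) → Set
  IsShortestPath u v p =
    IsPath u v p × (∀ p′ → IsPath u v p′ → length p ≤ length p′)

  -- No path with at least three vertices is closed up by an edge to a cycle.
  Acyclic : Set
  Acyclic = ∀ u v p → IsPath u v p → 3 ≤ length p → ¬ Adj v u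

  IsTree : Set
  IsTree = Connected × Acyclic

open Graph public

record TreeDecomposition {n : ℕ} (G : Graph n) : Set where
  field
    nodes        : ℕ
    tree         : Graph nodes
    isTree       : IsTree tree
    bag          : Fin nodes → Subset n
    coversVertex : ∀ v → ∃[ t ] v ∈ bag t
    coversEdge   : ∀ u v → Adj G u v → ∃[ t ] (u ∈ bag t × v ∈ bag t)
    coherent     : ∀ v s t p → v ∈ bag s → v ∈ bag t →
                   IsPath tree s t p → All (λ r → v ∈ bag r) p

  -- For n ≥ 1 some bag is nonempty, so the subtraction does not truncate.
  width : ℕ
  width = max 0 (tabulate (λ t → ∣ bag t ∣)) ∸ 1

open TreeDecomposition public using (width)

HasTreewidth : {n : ℕ} → Graph n → ℕ → Set
HasTreewidth G w =
  (Σ[ D ∈ TreeDecomposition G ] width D ≡ w) ×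
  (∀ (D : TreeDecomposition G) → w ≤ width D)

record Oracle {n : ℕ} (G : Graph n) : Set where
  field
    answer   : Fin n → Fin n → List (Fin n)
    shortest : ∀ u v → IsShortestPath G u v (answer u v)

-- A deterministic adaptive algorithm on the vertex set Fin n, as a decision
-- tree: either stop and output an edge set, or query a pair and continue
-- depending on the returned path.  The graph is accessible in no other way.
data Algorithm (n : ℕ) : Set where
  stop  : EdgeSet n → Algorithm n
  query : (u v : Fin n) → (List (Fin n) → Algorithm n) → Algorithm n

module _ {n : ℕ} {G : Graph n} (O : Oracle G) where
  open Oracle O

  output : Algorithm n → EdgeSet n
  output (stop E)      = E
  output (query u v k) = output (k (answer u v))

  queries : Algorithm n → ℕ
  queries (stop E)      = zero
  queries (query u v k) = suc (queries (k (answer u v)))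

-- Real bounds are expressed exactly, with no rounding, by quantifying over the
-- rationals a / b above the real number in question: if f is continuous and
-- increasing, then q ≤ f x iff q ≤ f (a / b) for all rationals a / b ≥ x.

-- log₂ n ≤ c / d
Log₂≤ : (n c d : ℕ) → Set
Log₂≤ n c d = n ^ d ≤ 2 ^ c

-- √((log₂ log₂ n + log₂ Δ) / log₂ n) ≤ a / b, for n ≥ 2.  Squaring and clearing
-- denominators gives (Δ log₂ n) ^ b² ≤ n ^ a²; here log₂ n is replaced by some
-- c / d above it, which leaves the infimum of the admissible a / b unchanged.
Root≤ : (n Δ a b : ℕ) → Set
Root≤ n Δ a b = ∃[ c ] ∃[ d ] (NonZero d × Log₂≤ n c d ×
  (Δ * c) ^ (b * b) ≤ n ^ (a * a) * d ^ (b * b))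

-- q ≤ n ^ (1 + C √((log₂ log₂ n + log₂ Δ) / log₂ n)), for n ≥ 2
GeneralBound : (C n Δ q : ℕ) → Set
GeneralBound C n Δ q = ∀ a b → NonZero b → Root≤ n Δ a b →
  q ^ b ≤ n ^ (b + C * a)

-- q ≤ C Δ (Δ + tw log₂ n) n (log₂ n)², for n ≥ 1, multiplied by d³ where
-- log₂ n ≤ c / d
TreewidthBound : (C n Δ tw q : ℕ) → Set
TreewidthBound C n Δ tw q = ∀ c d → NonZero d → Log₂≤ n c d →
  q * d ^ 3 ≤ C * (Δ * (Δ * d + tw * c) * n * c ^ 2)

{-# OPTIONS --safe #-}

-- Greedy set cover.  The algorithm keeps the known edges X and the undecided
-- pairs.  If a query to (p , q) returns a path shorter than the distance in X,
-- that path contains a new edge, which happens at most n Δ times.  Otherwise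
-- the distances in X rule out every edge {u , q} with d(p , u) + 1 < d(p , q);
-- the algorithm queries the pair that rules out most.  If some f queries
-- together rule out all nonedges of X, every such step removes a fraction 1 / f
-- of the undecided pairs, so O(f log n) steps suffice.  It remains to exhibit
-- such certificates for connected graphs X.
--
-- In general: choose centres A such that every cluster
-- C(w) = {v ∈ U : d(w , v) < d(A , v)} has at most |U| / s elements, query all
-- pairs in N₂(A) × U, and recurse on the clusters of the vertices in N₂(A); with
-- s ≈ n ^ (1 / k) the recursion has depth k.
--
-- In treewidth w: a bag S of a centroid of the decomposition splits U into parts
-- of half the size; querying N₁(S) × U rules out all edges between different
-- parts, so the recursion has depth log n.

module Submission where

open import Defs hiding (sym)
open import Data.Bool.Base using (Bool; true; false; T)
open import Data.Bool.Properties using (T?)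
open import Data.Empty using (⊥; ⊥-elim)
import Data.Fin.Base as Fin
open import Data.Fin.Base using (Fin)
open import Data.Fin.Properties using (_≟_; any?; injective⇒≤; nonZeroIndex)
import Data.Fin.Subset as Subset
open import Data.Fin.Subset using (Subset; ∣_∣)
open import Data.List.Base using (List; []; _∷_; _++_; length; map; filter; tabulate; head; last; lookup; allFin; concatMap; cartesianProduct)
open import Data.List.Extrema.Nat using (argmax; f[xs]≤f[argmax]; argmin; f[argmin]≤f[xs]; min; max; xs≤max; min≤v⁺; min≤⊤; argmin-sel)
open import Data.List.Membership.DecPropositional using (_∈?_)
open import Data.List.Membership.Propositional using (_∈_; lose)
open import Data.List.Membership.Propositional.Properties using (∈-allFin; ∈-lookup; ∈-filter⁺; ∈-filter⁻; ∈-map⁺; ∈-map⁻; ∈-concatMap⁺; ∈-cartesianProduct⁺; ∈-++⁺ˡ; ∈-++⁺ʳ; ∈-tabulate⁺)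
open import Data.List.Properties using (length-++; length-map; length-tabulate; length-filter)
open import Data.List.Relation.Unary.All as All using (All; []; _∷_)
open import Data.List.Relation.Unary.All.Properties using (¬Any⇒All¬)
open import Data.List.Relation.Unary.AllPairs using ([]; _∷_)
open import Data.List.Relation.Unary.Any using (here; there)
open import Data.List.Relation.Unary.Linked as Linked using (Linked; []; [-]; _∷_)
open import Data.List.Relation.Unary.Unique.Propositional using (Unique)
open import Data.Maybe.Base using (just)
open import Data.Nat.Base hiding (_/_; _%_)
open import Data.Nat.DivMod using (_/_; _%_; m≡m%n+[m/n]*n; m%n<n; m/n*n≤m)
open import Data.Nat.Properties renaming (_≟_ to _≟ℕ_)
open import Data.Nat.Tactic.RingSolver using (solve-∀)
open import Data.Product.Base using (Σ-syntax; ∃; ∃-syntax; _×_; _,_; proj₁; proj₂)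
open import Data.Sum.Base using (_⊎_; inj₁; inj₂)
import Data.Vec.Base as Vec
import Data.Vec.Properties as Vec
open import Function.Base using (id; _∘_; case_of_)
open import Function.Bundles using (mk⇔)
open import Relation.Binary.Construct.Closure.ReflexiveTransitive as Star using (Star; ε; _◅_; _◅◅_)
open import Relation.Binary.PropositionalEquality
open import Relation.Nullary using (¬_; Dec; yes; no; does; contradiction; _×-dec_; _⊎-dec_; ¬?)
open import Relation.Nullary.Decidable using (does-⇔)

-- Neither `Δ` nor a tree decomposition is given to the algorithm, so certificates occur only in the
-- analysis, and one greedy procedure meets both bounds. They are built for the known graph rather
-- than for `G`: it lies inside `G`, so its degrees are at most `Δ`, and every tree decomposition of
-- `G` also decomposes it. It has to be connected, though; while some pair is unreachable in it,
-- such a pair is queried, and the answer must contain a new edge. The exponent comes from balancing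
-- two costs. A level of the general recursion multiplies the number of sets by about `s` times a
-- power of `Δ log n` and divides their size by `s`, so depth k costs n^(1 + 1/k) (Δ log n)^O(k). If
-- ρ is the root in the exponent, then Δ log n = n^(ρ²), and k near 1/ρ makes both excess factors
-- n^O(ρ).

private variable
  A B : Set
  P Q : Set
  n : ℕ

-- Sums over lists and counting

∑ : List A → (A → ℕ) → ℕ
∑ []       f = 0
∑ (x ∷ xs) f = f x + ∑ xs f

𝟙 : Dec P → ℕ
𝟙 (yes _) = 1
𝟙 (no  _) = 0

𝟙-mono : (p : Dec P) (q : Dec Q) → (P → Q) → 𝟙 p ≤ 𝟙 q
𝟙-mono (no _)  _       f = z≤n
𝟙-mono (yes p) (yes _) f = ≤-refl
𝟙-mono (yes p) (no ¬q) f = contradiction (f p) ¬q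

𝟙-yes : (p : Dec P) → P → 𝟙 p ≡ 1
𝟙-yes (yes _) p = refl
𝟙-yes (no ¬p) p = contradiction p ¬p

𝟙-no : (p : Dec P) → ¬ P → 𝟙 p ≡ 0
𝟙-no (yes p) ¬p = contradiction p ¬p
𝟙-no (no _)  ¬p = refl

𝟙≤1 : (p : Dec P) → 𝟙 p ≤ 1
𝟙≤1 (yes _) = ≤-refl
𝟙≤1 (no  _) = z≤n

𝟙-× : (p : Dec P) (q : Dec Q) → 𝟙 (p ×-dec q) ≡ 𝟙 p * 𝟙 q
𝟙-× (yes _) (yes _) = refl
𝟙-× (yes _) (no  _) = refl
𝟙-× (no  _) (yes _) = refl
𝟙-× (no  _) (no  _) = refl

𝟙-disjoint : {R : Set} (p : Dec P) (q : Dec Q) (r : Dec R) →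
  (P → R) → (Q → R) → (P → ¬ Q) → 𝟙 p + 𝟙 q ≤ 𝟙 r
𝟙-disjoint (yes p) q r f g d rewrite 𝟙-no q (d p) | 𝟙-yes r (f p) = ≤-refl
𝟙-disjoint (no _)  q r f g d = 𝟙-mono q r g

∑-mono : (xs : List A) {f g : A → ℕ} → (∀ x → f x ≤ g x) → ∑ xs f ≤ ∑ xs g
∑-mono []       h = z≤n
∑-mono (x ∷ xs) h = +-mono-≤ (h x) (∑-mono xs h)

∑-cong : (xs : List A) {f g : A → ℕ} → (∀ x → f x ≡ g x) → ∑ xs f ≡ ∑ xs g
∑-cong []       h = refl
∑-cong (x ∷ xs) h = cong₂ _+_ (h x) (∑-cong xs h)

∑-zero : (xs : List A) → ∑ xs (λ _ → 0) ≡ 0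
∑-zero []       = refl
∑-zero (_ ∷ xs) = ∑-zero xs

+-interchange : ∀ a b c d → (a + b) + (c + d) ≡ (a + c) + (b + d)
+-interchange a b c d = begin
  (a + b) + (c + d)  ≡⟨ +-assoc a b (c + d) ⟩
  a + (b + (c + d))  ≡⟨ cong (a +_) (+-assoc b c d) ⟨
  a + (b + c + d)    ≡⟨ cong (λ x → a + (x + d)) (+-comm b c) ⟩
  a + (c + b + d)    ≡⟨ cong (a +_) (+-assoc c b d) ⟩
  a + (c + (b + d))  ≡⟨ +-assoc a c (b + d) ⟨
  (a + c) + (b + d)  ∎
  where open ≡-Reasoning

∑-+ : (xs : List A) (f g : A → ℕ) → ∑ xs (λ x → f x + g x) ≡ ∑ xs f + ∑ xs g
∑-+ []       f g = refl
∑-+ (x ∷ xs) f g = trans (cong (f x + g x +_) (∑-+ xs f g)) (+-interchange (f x) (g x) _ _)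

∑-*ˡ : (xs : List A) (c : ℕ) (f : A → ℕ) → ∑ xs (λ x → c * f x) ≡ c * ∑ xs f
∑-*ˡ []       c f = sym (*-zeroʳ c)
∑-*ˡ (x ∷ xs) c f = trans (cong (c * f x +_) (∑-*ˡ xs c f)) (sym (*-distribˡ-+ c (f x) _))

∑-*ʳ : (xs : List A) (c : ℕ) (f : A → ℕ) → ∑ xs (λ x → f x * c) ≡ ∑ xs f * c
∑-*ʳ xs c f = trans (∑-cong xs (λ x → *-comm (f x) c)) (trans (∑-*ˡ xs c f) (*-comm c _))

∑-swap : (xs : List A) (ys : List B) (f : A → B → ℕ) →
  ∑ xs (λ x → ∑ ys (f x)) ≡ ∑ ys (λ y → ∑ xs (λ x → f x y))
∑-swap []       ys f = sym (∑-zero ys)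
∑-swap (x ∷ xs) ys f = trans (cong (∑ ys (f x) +_) (∑-swap xs ys f)) (sym (∑-+ ys (f x) _))

∑-∈ : {xs : List A} {x : A} (f : A → ℕ) → x ∈ xs → f x ≤ ∑ xs f
∑-∈ f (here refl) = m≤m+n _ _
∑-∈ f (there i)   = ≤-trans (∑-∈ f i) (m≤n+m _ _)

∑-bound : (xs : List A) {f : A → ℕ} {c : ℕ} → (∀ x → f x ≤ c) → ∑ xs f ≤ length xs * c
∑-bound []       h = z≤n
∑-bound (x ∷ xs) h = +-mono-≤ (h x) (∑-bound xs h)

∑-pos : (xs : List A) {f : A → ℕ} → 0 < ∑ xs f → ∃[ x ] 0 < f x
∑-pos (x ∷ xs) {f} h with f x in eq
... | suc m = x , subst (0 <_) (sym eq) z<s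
... | zero  = ∑-pos xs h

∑-strict : {xs : List A} {x : A} {f g : A → ℕ} → (∀ y → f y ≤ g y) →
  x ∈ xs → f x < g x → ∑ xs f < ∑ xs g
∑-strict {xs = _ ∷ xs} h (here refl) l = +-mono-<-≤ l (∑-mono xs h)
∑-strict {xs = y ∷ _}  h (there i)   l = +-mono-≤-< (h y) (∑-strict h i l)

length-filter≡∑ : {P : A → Set} (P? : ∀ x → Dec (P x)) (xs : List A) →
  length (filter P? xs) ≡ ∑ xs (λ x → 𝟙 (P? x))
length-filter≡∑ P? []       = refl
length-filter≡∑ P? (x ∷ xs) with P? x
... | yes _ = cong suc (length-filter≡∑ P? xs)
... | no  _ = length-filter≡∑ P? xs

-- Walks, paths and truncated distances

data Walk (R : A → A → Set) : ℕ → A → A → Set where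
  nil  : ∀ {u} → Walk R 0 u u
  cons : ∀ {m u w v} → R u w → Walk R m w v → Walk R (suc m) u v

module _ {R S : A → A → Set} where

  walk-map : ∀ {m u v} → (∀ {x y} → R x y → S x y) → Walk R m u v → Walk S m u v
  walk-map f nil        = nil
  walk-map f (cons e w) = cons (f e) (walk-map f w)

module _ {R : A → A → Set} where

  walk-snoc : ∀ {m u v w} → Walk R m u v → R v w → Walk R (suc m) u w
  walk-snoc nil        e = cons e nil
  walk-snoc (cons d p) e = cons d (walk-snoc p e)

  star⇒walk : ∀ {u v} → Star R u v → ∃[ m ] Walk R m u v
  star⇒walk ε       = 0 , nil
  star⇒walk (e ◅ s) = _ , cons e (proj₂ (star⇒walk s))

  walk⇒star : ∀ {m u v} → Walk R m u v → Star R u v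
  walk⇒star nil        = ε
  walk⇒star (cons e w) = e ◅ walk⇒star w

  linked⇒walk : ∀ {u v} (p : List A) → head p ≡ just u → last p ≡ just v → Linked R p →
    Walk R (pred (length p)) u v
  linked⇒walk (x ∷ [])     refl refl _       = nil
  linked⇒walk (x ∷ y ∷ p) refl l    (e ∷ es) = cons e (linked⇒walk (y ∷ p) refl l es)

SimplePath : (R : A → A → Set) → A → A → List A → Set
SimplePath R u v p = head p ≡ just u × last p ≡ just v × Linked R p × Unique p

last-∷ : ∀ {w v : A} (u : A) (p : List A) → head p ≡ just w → last p ≡ just v → last (u ∷ p) ≡ just v
last-∷ u (_ ∷ _) _ l = l

linked-∷ : ∀ {R : A → A → Set} {u w : A} (p : List A) → head p ≡ just w → R u w → Linked R p → Linked R (u ∷ p)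
linked-∷ (_ ∷ _) refl e es = e ∷ es

simplePath-suffix : ∀ {R : A → A → Set} {u w v} (p : List A) → SimplePath R w v p → u ∈ p →
  ∃[ q ] SimplePath R u v q × length q ≤ length p
simplePath-suffix (x ∷ p)     h (here refl) = x ∷ p , (refl , proj₂ h) , ≤-refl
simplePath-suffix (x ∷ y ∷ p) (_ , l , _ ∷ es , _ ∷ un) (there i)
  with q , sp , le ← simplePath-suffix (y ∷ p) (refl , l , es , un) i = q , sp , m≤n⇒m≤1+n le

walk⇒simplePath : ∀ {R : Fin n → Fin n → Set} {m u v} → Walk R m u v →
  ∃[ p ] SimplePath R u v p × length p ≤ suc m
walk⇒simplePath {u = u} nil = u ∷ [] , (refl , refl , [-] , [] ∷ []) , ≤-refl
walk⇒simplePath {u = u} (cons e w) with p , sp@(h , l , es , un) , le ← walk⇒simplePath w | _∈?_ _≟_ u p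
... | yes i with q , sq , le′ ← simplePath-suffix p sp i = q , sq , ≤-trans le′ (m≤n⇒m≤1+n le)
... | no ¬i = u ∷ p , (refl , last-∷ u p h l , linked-∷ p h e es , ¬Any⇒All¬ p ¬i ∷ un) , s≤s le

unique-lookup-injective : ∀ {xs : List A} → Unique xs → ∀ {i j} → lookup xs i ≡ lookup xs j → i ≡ j
unique-lookup-injective {xs = x ∷ xs} (px ∷ un) {Fin.zero}  {Fin.zero}  eq = refl
unique-lookup-injective {xs = x ∷ xs} (px ∷ un) {Fin.zero}  {Fin.suc j} eq = ⊥-elim (All.lookup px (∈-lookup j) eq)
unique-lookup-injective {xs = x ∷ xs} (px ∷ un) {Fin.suc i} {Fin.zero}  eq = ⊥-elim (All.lookup px (∈-lookup i) (sym eq))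
unique-lookup-injective {xs = x ∷ xs} (px ∷ un) {Fin.suc i} {Fin.suc j} eq = cong Fin.suc (unique-lookup-injective un eq)

unique-length : (xs : List (Fin n)) → Unique xs → length xs ≤ n
unique-length xs un = injective⇒≤ {f = lookup xs} (unique-lookup-injective un)

Edge : EdgeSet n → Fin n → Fin n → Set
Edge E u v = T (E u v)

neighbours : EdgeSet n → Fin n → List (Fin n)
neighbours E u = filter (λ w → T? (E u w)) (allFin _)

-- dist E k u v is the minimum of k and the distance from u to v.
dist : EdgeSet n → ℕ → Fin n → Fin n → ℕ
dist E zero    u v = 0
dist E (suc k) u v with u ≟ v
... | yes _ = 0
-- The default `k` of `min` is the truncation: it is the value if no neighbour is nearer to `v` than
-- `k`.
... | no  _ = suc (min k (map (λ w → dist E k w v) (neighbours E u)))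

min-attained : ∀ k xs → min k xs < k → min k xs ∈ xs
min-attained k xs lt with argmin-sel id k xs
... | inj₁ eq = ⊥-elim (<-irrefl eq lt)
... | inj₂ i  = i

module _ (E : EdgeSet n) where

  dist≤ : ∀ k u v → dist E k u v ≤ k
  dist≤ zero    u v = z≤n
  dist≤ (suc k) u v with u ≟ v
  ... | yes _ = z≤n
  ... | no  _ = s≤s (min≤⊤ k (map (λ w → dist E k w v) (neighbours E u)))

  dist≤walk : ∀ k {m u v} → Walk (Edge E) m u v → dist E k u v ≤ m
  dist≤walk zero w = z≤n
  dist≤walk (suc k) {u = u} {v} w with u ≟ v
  dist≤walk (suc k) w          | yes _   = z≤n
  dist≤walk (suc k) nil        | no u≢u  = contradiction refl u≢u
  dist≤walk (suc k) {u = u} {v} (cons {w = x} e w) | no _ =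
    s≤s (min≤v⁺ k (map (λ w → dist E k w v) (neighbours E u))
      (inj₂ (lose (∈-map⁺ _ (∈-filter⁺ (λ w → T? (E u w)) (∈-allFin x) e)) (dist≤walk k w))))

  dist-walk : ∀ k u v → dist E k u v < k → Walk (Edge E) (dist E k u v) u v
  dist-walk (suc k) u v lt with u ≟ v
  ... | yes refl = nil
  ... | no  _    with ∈-map⁻ _ (min-attained k (map (λ w → dist E k w v) (neighbours E u)) (s<s⁻¹ lt))
  ...   | w , i , eq rewrite eq =
    cons (proj₂ (∈-filter⁻ (λ w → T? (E u w)) {xs = allFin _} i)) (dist-walk k w v (s<s⁻¹ lt))

  -- A simple path has at most `n` vertices, hence fewer than `n` edges. So truncation at `n` loses
  -- nothing, and the value `n` means unreachable.
  walk⇒dist< : ∀ {m u v} → Walk (Edge E) m u v → dist E n u v < n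
  walk⇒dist< w with p , (h , l , es , un) , _ ← walk⇒simplePath w = begin-strict
    dist E n _ _      ≤⟨ dist≤walk n (linked⇒walk p h l es) ⟩
    pred (length p)   <⟨ pred< p h ⟩
    length p          ≤⟨ unique-length p un ⟩
    n                 ∎
    where
    open ≤-Reasoning
    pred< : ∀ {u : Fin n} p → head p ≡ just u → pred (length p) < length p
    pred< (_ ∷ _) _ = ≤-refl

  star? : ∀ u v → Dec (Star (Edge E) u v)
  star? u v with dist E n u v <? n
  ... | yes lt = yes (walk⇒star (dist-walk n u v lt))
  ... | no ¬lt = no λ s → ¬lt (walk⇒dist< (proj₂ (star⇒walk s)))

-- Geometric decrease

2ab≤a²+b²-ordered : ∀ {a b} → a ≤ b → 2 * (a * b) ≤ a * a + b * b
2ab≤a²+b²-ordered {a} a≤b with k , refl ← m≤n⇒∃[o]m+o≡n a≤b =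
  ≤-trans (m≤m+n _ (k * k)) (≤-reflexive (identity a k))
  where
  identity : ∀ a k → 2 * (a * (a + k)) + k * k ≡ a * a + (a + k) * (a + k)
  identity = solve-∀

2ab≤a²+b² : ∀ a b → 2 * (a * b) ≤ a * a + b * b
2ab≤a²+b² a b with ≤-total a b
... | inj₁ a≤b = 2ab≤a²+b²-ordered a≤b
... | inj₂ b≤a = subst₂ _≤_ (cong (2 *_) (*-comm b a)) (+-comm (b * b) (a * a)) (2ab≤a²+b²-ordered b≤a)

∑-square : (xs : List A) (f : A → ℕ) → ∑ xs f * ∑ xs f ≡ ∑ xs (λ x → ∑ xs (λ y → f x * f y))
∑-square xs f = trans (sym (∑-*ʳ xs (∑ xs f) f)) (∑-cong xs (λ x → sym (∑-*ˡ xs (f x) f)))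

∑-const : (xs : List A) (c : ℕ) → ∑ xs (λ _ → c) ≡ length xs * c
∑-const []       c = refl
∑-const (x ∷ xs) c = cong (c +_) (∑-const xs c)

-- Summing `2ab ≤ a² + b²` over all ordered pairs of entries counts each square `2 * length xs`
-- times, and the 2 cancels.
cauchy-schwarz : (xs : List A) (f : A → ℕ) →
  ∑ xs f * ∑ xs f ≤ length xs * ∑ xs (λ x → f x * f x)
cauchy-schwarz xs f = *-cancelˡ-≤ 2 (begin
  2 * (∑ xs f * ∑ xs f)                              ≡⟨ cong (2 *_) (∑-square xs f) ⟩
  2 * ∑ xs (λ x → ∑ xs (λ y → f x * f y))            ≡⟨ ∑-*ˡ xs 2 _ ⟨
  ∑ xs (λ x → 2 * ∑ xs (λ y → f x * f y))            ≡⟨ ∑-cong xs (λ x → ∑-*ˡ xs 2 _) ⟨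
  ∑ xs (λ x → ∑ xs (λ y → 2 * (f x * f y)))          ≤⟨ ∑-mono xs (λ x → ∑-mono xs (λ y → 2ab≤a²+b² (f x) (f y))) ⟩
  ∑ xs (λ x → ∑ xs (λ y → sq x + sq y))              ≡⟨ ∑-cong xs (λ x → ∑-+ xs _ sq) ⟩
  ∑ xs (λ x → ∑ xs (λ _ → sq x) + T²)                ≡⟨ ∑-+ xs _ _ ⟩
  ∑ xs (λ x → ∑ xs (λ _ → sq x)) + ∑ xs (λ _ → T²)   ≡⟨ cong (_+ ∑ xs (λ _ → T²)) (∑-swap xs xs _) ⟩
  ∑ xs (λ _ → T²) + ∑ xs (λ _ → T²)                  ≡⟨ cong₂ _+_ (∑-const xs T²) (∑-const xs T²) ⟩
  length xs * T² + length xs * T²                    ≡⟨ cong (length xs * T² +_) (+-identityʳ _) ⟨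
  2 * (length xs * T²)                               ∎)
  where
  open ≤-Reasoning
  sq : _ → ℕ
  sq x = f x * f x
  T² = ∑ xs sq

-- A quantity u that loses at least u / f at each step vanishes after N steps:
-- while 2 ^ j ≤ u < 2 ^ suc j each step loses 2 ^ j / f, and m counts the
-- steps left in this phase.
Steps : (f u N : ℕ) → Set
Steps f u N = ∃[ j ] ∃[ m ] (u * f < 2 ^ j * (f + m) × f * j + m ≤ N)

steps-start : ∀ {f u J} .{{_ : NonZero f}} → u < 2 ^ J → Steps f u (f * J)
steps-start {f} {u} {J} lt = J , 0 , (begin-strict
  u * f            <⟨ *-monoˡ-< f lt ⟩
  2 ^ J * f        ≡⟨ cong (2 ^ J *_) (+-identityʳ f) ⟨
  2 ^ J * (f + 0)  ∎) , ≤-reflexive (+-identityʳ _)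
  where open ≤-Reasoning

steps-mono : ∀ {f u u′ N} → u′ ≤ u → Steps f u N → Steps f u′ N
steps-mono {f} le (j , m , lt , b) = j , m , ≤-<-trans (*-monoˡ-≤ f le) lt , b

-- While `2 ^ j ≤ u`, the loss `g` satisfies `f * g ≥ 2 ^ j`, which pays for lowering `m` by one;
-- `m` cannot be 0 there, as that would give `u < 2 ^ j`. Once `u < 2 ^ j`, the next lower phase
-- opens with `f` fresh steps.
steps-step : ∀ {f u u′ g N} → 0 < u → u ≤ f * g → u′ + g ≤ u → Steps f u N →
  ∃[ N′ ] (N ≡ suc N′ × Steps f u′ N′)
steps-step {f} {u} {u′} {g} {N} pos gain decr (j , m , lt , b) = go j m lt b
  where
  open ≤-Reasoning
  go : ∀ j m → u * f < 2 ^ j * (f + m) → f * j + m ≤ N → ∃[ N′ ] (N ≡ suc N′ × Steps f u′ N′)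
  go j m lt b with 2 ^ j ≤? u
  go j zero lt b | yes big = ⊥-elim (<-irrefl refl (begin-strict
    u * f            <⟨ lt ⟩
    2 ^ j * (f + 0)  ≡⟨ cong (2 ^ j *_) (+-identityʳ f) ⟩
    2 ^ j * f        ≤⟨ *-monoˡ-≤ f big ⟩
    u * f            ∎))
  go j (suc m) lt b | yes big = case m≤n⇒∃[o]m+o≡n (≤-trans (≤-reflexive (sym (+-suc (f * j) m))) b) of λ where
    (o , refl) → f * j + m + o , refl , j , m , +-cancelʳ-< (2 ^ j) _ _ (begin-strict
      u′ * f + 2 ^ j           ≤⟨ +-monoʳ-≤ (u′ * f) (≤-trans big gain) ⟩
      u′ * f + f * g           ≡⟨ cong (u′ * f +_) (*-comm f g) ⟩
      u′ * f + g * f           ≡⟨ *-distribʳ-+ f u′ g ⟨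
      (u′ + g) * f             ≤⟨ *-monoˡ-≤ f decr ⟩
      u * f                    <⟨ lt ⟩
      2 ^ j * (f + suc m)      ≡⟨ cong (2 ^ j *_) (+-suc f m) ⟩
      2 ^ j * suc (f + m)      ≡⟨ *-suc (2 ^ j) (f + m) ⟩
      2 ^ j + 2 ^ j * (f + m)  ≡⟨ +-comm (2 ^ j) _ ⟩
      2 ^ j * (f + m) + 2 ^ j  ∎) , m≤m+n _ o
  go zero    m lt b | no small = contradiction pos small
  go (suc j) m lt b | no small = go j f
    (begin-strict
      u * f            <⟨ *-monoˡ-< f {{f≢0}} (≰⇒> small) ⟩
      2 * 2 ^ j * f    ≡⟨ identity (2 ^ j) f ⟩
      2 ^ j * (f + f)  ∎)
    (begin
      f * j + f  ≡⟨ trans (+-comm _ f) (sym (*-suc f j)) ⟩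
      f * suc j  ≤⟨ m≤m+n _ m ⟩
      f * suc j + m ≤⟨ b ⟩
      N          ∎)
    where
    f≢0 : NonZero f
    f≢0 = m*n≢0⇒m≢0 f {{>-nonZero (<-≤-trans pos gain)}}
    identity : ∀ p f → 2 * p * f ≡ p * (f + f)
    identity = solve-∀

module _ (Φ : List A → ℕ) (f : ℕ)
  (step : ∀ xs → 0 < Φ xs → ∃[ x ] ∃[ g ] (Φ xs ≤ f * g × Φ (x ∷ xs) + g ≤ Φ xs)) where

  exhaust : ∀ N xs → Steps f (Φ xs) N →
    ∃[ ys ] (length ys ≤ length xs + N × (∀ {x} → x ∈ xs → x ∈ ys) × Φ ys ≡ 0)
  exhaust N xs st with Φ xs ≟ℕ 0
  ... | yes eq = xs , m≤m+n _ N , id , eq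
  ... | no ¬eq with x , g , le , decr ← step xs (n≢0⇒n>0 ¬eq)
      with N′ , refl , st′ ← steps-step (n≢0⇒n>0 ¬eq) le decr st
      with ys , len , sub , Φ≡0 ← exhaust N′ (x ∷ xs) st′ =
    ys , ≤-trans len (≤-reflexive (sym (+-suc (length xs) N′))) , (λ i → sub (there i)) , Φ≡0

maximiser : (f : A → ℕ) (x₀ : A) (xs : List A) → ∃[ a ] (∀ {x} → x ∈ xs → f x ≤ f a)
maximiser f x₀ xs = argmax f x₀ xs , All.lookup (f[xs]≤f[argmax] x₀ xs)

minimiser : (f : A → ℕ) {x₀ : A} (xs : List A) → x₀ ∈ xs →
  ∃[ a ] (a ∈ xs × (∀ {x} → x ∈ xs → f a ≤ f x))
minimiser f {x₀} xs i = argmin f x₀ xs , a∈xs , All.lookup (f[argmin]≤f[xs] x₀ xs)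
  where
  a∈xs : argmin f x₀ xs ∈ xs
  a∈xs with argmin-sel f x₀ xs
  ... | inj₁ eq = subst (_∈ xs) (sym eq) i
  ... | inj₂ j  = j

length-concatMap : (f : A → List B) {c : ℕ} → (∀ x → length (f x) ≤ c) →
  ∀ xs → length (concatMap f xs) ≤ length xs * c
length-concatMap f h []       = z≤n
length-concatMap f h (x ∷ xs) = ≤-trans (≤-reflexive (length-++ (f x)))
  (+-mono-≤ (h x) (length-concatMap f h xs))

∈-concatMap : (f : A → List B) {xs : List A} {x : A} {y : B} → x ∈ xs → y ∈ f x → y ∈ concatMap f xs
∈-concatMap f i j = ∈-concatMap⁺ f (lose i j)

-- Certificates

-- If a query to (p , q) returns no path shorter than in E, then it rules out
-- every pair {u , v} with q = v and dist(p , u) + 1 < dist(p , v).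
Resolves : EdgeSet n → Fin n × Fin n → Fin n → Fin n → Set
Resolves {n} E (p , q) u v =
  (q ≡ v × suc (dist E n p u) < dist E n p v) ⊎ (q ≡ u × suc (dist E n p v) < dist E n p u)

resolves? : (E : EdgeSet n) (pq : Fin n × Fin n) (u v : Fin n) → Dec (Resolves E pq u v)
resolves? E (p , q) u v = ((q ≟ v) ×-dec (_ <? _)) ⊎-dec ((q ≟ u) ×-dec (_ <? _))

resolves-sym : {E : EdgeSet n} {pq : Fin n × Fin n} {u v : Fin n} → Resolves E pq u v → Resolves E pq v u
resolves-sym (inj₁ r) = inj₂ r
resolves-sym (inj₂ r) = inj₁ r

Certificate : EdgeSet n → List (Fin n × Fin n) → Set
Certificate E Q = ∀ u v → u ≢ v → ¬ Edge E u v → ∃[ pq ] (pq ∈ Q × Resolves E pq u v)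

-- All that certificates require of the known graph. `reachable` expresses connectedness, `n` being
-- the value of `dist` at unreachable pairs.
record Known (n Δ : ℕ) : Set where
  field
    edgeSet   : EdgeSet n
    symmetric : ∀ {u v} → Edge edgeSet u v → Edge edgeSet v u
    reachable : ∀ u v → dist edgeSet n u v < n
    degree≤   : ∀ u → length (neighbours edgeSet u) ≤ Δ

module Metric {n Δ : ℕ} (K : Known n Δ) where
  open Known K renaming (edgeSet to E)

  d : Fin n → Fin n → ℕ
  d = dist E n

  geodesic : ∀ u v → Walk (Edge E) (d u v) u v
  geodesic u v = dist-walk E n u v (reachable u v)

  d≤walk : ∀ {m u v} → Walk (Edge E) m u v → d u v ≤ m
  d≤walk = dist≤walk E n

  d-refl : ∀ u → d u u ≡ 0
  d-refl u = n≤0⇒n≡0 (d≤walk nil)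

  d≡0⇒≡ : ∀ {u v} → d u v ≡ 0 → u ≡ v
  d≡0⇒≡ {u} {v} eq with d u v | geodesic u v
  d≡0⇒≡ refl | .0 | nil = refl

  d-edge : ∀ {u w v} → Edge E u w → d u v ≤ suc (d w v)
  d-edge e = d≤walk (cons e (geodesic _ _))

  d-next : ∀ {u v m} → d u v ≡ suc m → ∃[ w ] (Edge E u w × d w v ≡ m)
  d-next {u} {v} eq with d u v in eq′ | geodesic u v
  d-next {u} {v} refl | .(suc _) | cons {w = w} e p =
    w , e , ≤-antisym (d≤walk p) (s≤s⁻¹ (≤-trans (≤-reflexive (sym eq′)) (d-edge e)))

  nonEdge⇒1<d : ∀ {u v} → u ≢ v → ¬ Edge E u v → 1 < d u v
  nonEdge⇒1<d {u} {v} u≢v ¬e with d u v | geodesic u v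
  ... | 0           | nil          = contradiction refl u≢v
  ... | 1           | cons e nil   = contradiction e ¬e
  ... | suc (suc _) | _            = s≤s (s≤s z≤n)

  self-resolves : ∀ {u v} → u ≢ v → ¬ Edge E u v → Resolves E (u , v) u v
  self-resolves {u} u≢v ¬e = inj₁ (refl , subst (λ x → suc x < d u _) (sym (d-refl u)) (nonEdge⇒1<d u≢v ¬e))

  closedNeighbours : Fin n → List (Fin n)
  closedNeighbours u = u ∷ neighbours E u

  expand : List (Fin n) → List (Fin n)
  expand = concatMap closedNeighbours

  length-expand : ∀ xs → length (expand xs) ≤ length xs * suc Δ
  length-expand = length-concatMap closedNeighbours (λ u → s≤s (degree≤ u))

  ⊆-expand : ∀ {u xs} → u ∈ xs → u ∈ expand xs
  ⊆-expand i = ∈-concatMap closedNeighbours i (here refl)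

  edge-expand : ∀ {u v xs} → u ∈ xs → Edge E u v → v ∈ expand xs
  edge-expand {u} {v} i e =
    ∈-concatMap closedNeighbours i (there (∈-filter⁺ (λ w → T? (E u w)) (∈-allFin v) e))

-- Thorup–Zwick centres

module Centres {n Δ : ℕ} (K : Known n Δ) where
  open Metric K

  Near : List (Fin n) → Fin n → Fin n → Set
  Near A w v = All (λ a → d w v < d a v) A

  near? : ∀ A w v → Dec (Near A w v)
  near? A w v = All.all? (λ a → d w v <? d a v) A

  cluster : List (Fin n) → List (Fin n) → Fin n → List (Fin n)
  cluster A U w = filter (near? A w) U

  module _ (U : List (Fin n)) (M s : ℕ) (small : length U ≤ s * M) where

    V : List (Fin n)
    V = allFin n

    size : List (Fin n) → Fin n → ℕ
    size A w = ∑ U (λ v → 𝟙 (near? A w v))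

    heavy : List (Fin n) → Fin n → ℕ
    heavy A w = 𝟙 (M <? size A w)

    -- The total size of the oversized clusters, a potential that vanishes only when none is left.
    -- Light clusters are left out so that `Φ` is at least `M` times the number of clusters it
    -- counts.
    Φ : List (Fin n) → ℕ
    Φ A = ∑ V (λ w → heavy A w * size A w)

    module Step (A : List (Fin n)) where

      x : Fin n → Fin n → ℕ
      x v w = heavy A w * 𝟙 (near? A w v)

      -- The size of the bunch of `v`, restricted to heavy vertices: clusters and bunches are the
      -- two sides of one incidence relation.
      b : Fin n → ℕ
      b v = ∑ V (x v)

      le : Fin n → Fin n → Fin n → ℕ
      le v a w = 𝟙 (d a v ≤? d w v)

      gain : Fin n → ℕ
      gain a = ∑ V (λ w → ∑ U (λ v → x v w * le v a w))

      Φ≡∑b : Φ A ≡ ∑ U b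
      Φ≡∑b = trans (∑-cong V (λ w → sym (∑-*ˡ U (heavy A w) _))) (∑-swap V U _)

      size-decrease : ∀ a w → size (a ∷ A) w + ∑ U (λ v → 𝟙 (near? A w v) * le v a w) ≤ size A w
      size-decrease a w = begin
        size (a ∷ A) w + ∑ U (λ v → 𝟙 (near? A w v) * le v a w)
          ≡⟨ ∑-+ U _ _ ⟨
        ∑ U (λ v → 𝟙 (near? (a ∷ A) w v) + 𝟙 (near? A w v) * le v a w)
          ≤⟨ ∑-mono U pointwise ⟩
        size A w ∎
        where
        open ≤-Reasoning
        pointwise : ∀ v → 𝟙 (near? (a ∷ A) w v) + 𝟙 (near? A w v) * le v a w ≤ 𝟙 (near? A w v)
        pointwise v = subst (λ z → 𝟙 (near? (a ∷ A) w v) + z ≤ _)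
          (𝟙-× (near? A w v) (d a v ≤? d w v))
          (𝟙-disjoint (near? (a ∷ A) w v) (near? A w v ×-dec (d a v ≤? d w v)) (near? A w v)
            All.tail proj₁ (λ p q → <⇒≱ (All.head p) (proj₂ q)))

      -- A new centre only shrinks clusters, so no light cluster turns heavy, and `gain a` counts
      -- the incidences that disappear from heavy ones.
      Φ-decrease : ∀ a → Φ (a ∷ A) + gain a ≤ Φ A
      Φ-decrease a = begin
        Φ (a ∷ A) + gain a
          ≡⟨ ∑-+ V _ _ ⟨
        ∑ V (λ w → heavy (a ∷ A) w * size (a ∷ A) w + ∑ U (λ v → x v w * le v a w))
          ≤⟨ ∑-mono V pointwise ⟩
        Φ A ∎
        where
        open ≤-Reasoning
        pointwise : ∀ w → heavy (a ∷ A) w * size (a ∷ A) w + ∑ U (λ v → x v w * le v a w) ≤ heavy A w * size A w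
        pointwise w = begin
          heavy (a ∷ A) w * size (a ∷ A) w + ∑ U (λ v → x v w * le v a w)
            ≤⟨ +-monoˡ-≤ _ (*-monoˡ-≤ (size (a ∷ A) w) (𝟙-mono (M <? size (a ∷ A) w) (M <? size A w)
                 (λ lt → <-≤-trans lt (m+n≤o⇒m≤o (size (a ∷ A) w) (size-decrease a w))))) ⟩
          heavy A w * size (a ∷ A) w + ∑ U (λ v → x v w * le v a w)
            ≡⟨ cong (heavy A w * size (a ∷ A) w +_)
                 (trans (∑-cong U (λ v → *-assoc (heavy A w) _ _)) (∑-*ˡ U (heavy A w) _)) ⟩
          heavy A w * size (a ∷ A) w + heavy A w * ∑ U (λ v → 𝟙 (near? A w v) * le v a w)
            ≡⟨ *-distribˡ-+ (heavy A w) _ _ ⟨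
          heavy A w * (size (a ∷ A) w + ∑ U (λ v → 𝟙 (near? A w v) * le v a w))
            ≤⟨ *-monoʳ-≤ (heavy A w) (size-decrease a w) ⟩
          heavy A w * size A w ∎

      -- The factor `heavy A a` confines the candidate centres to the `W` heavy vertices, over which
      -- the gain is averaged below.
      y : Fin n → Fin n → Fin n → ℕ
      y v a w = heavy A a * (x v w * le v a w)

      -- Of two vertices a and w near v, the closer one, as a new centre,
      -- removes v from the cluster of the other.
      b²≤ : ∀ v → b v * b v ≤ 2 * ∑ V (λ a → ∑ V (y v a))
      b²≤ v = begin
        b v * b v                                      ≡⟨ ∑-square V (x v) ⟩
        ∑ V (λ a → ∑ V (λ w → x v a * x v w))          ≤⟨ ∑-mono V (λ a → ∑-mono V (pointwise a)) ⟩
        ∑ V (λ a → ∑ V (λ w → y v a w + y v w a))      ≡⟨ ∑-cong V (λ a → ∑-+ V _ _) ⟩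
        ∑ V (λ a → ∑ V (y v a) + ∑ V (λ w → y v w a))  ≡⟨ ∑-+ V _ _ ⟩
        Y + ∑ V (λ a → ∑ V (λ w → y v w a))            ≡⟨ cong (Y +_) (∑-swap V V _) ⟩
        Y + Y                                          ≡⟨ cong (Y +_) (+-identityʳ Y) ⟨
        2 * Y                                          ∎
        where
        open ≤-Reasoning
        Y = ∑ V (λ a → ∑ V (y v a))
        x≤heavy : ∀ w → x v w ≤ heavy A w
        x≤heavy w = ≤-trans (*-monoʳ-≤ (heavy A w) (𝟙≤1 (near? A w v))) (≤-reflexive (*-identityʳ _))
        below : ∀ a w → d a v ≤ d w v → x v a * x v w ≤ y v a w
        below a w h = *-mono-≤ (x≤heavy a)
          (≤-reflexive (sym (trans (cong (x v w *_) (𝟙-yes (d a v ≤? d w v) h)) (*-identityʳ _))))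
        pointwise : ∀ a w → x v a * x v w ≤ y v a w + y v w a
        pointwise a w with ≤-total (d a v) (d w v)
        ... | inj₁ h = ≤-trans (below a w h) (m≤m+n _ _)
        ... | inj₂ h = ≤-trans (≤-trans (≤-reflexive (*-comm (x v a) (x v w))) (below w a h)) (m≤n+m _ _)

      W : ℕ
      W = ∑ V (heavy A)

      W*M≤Φ : W * M ≤ Φ A
      W*M≤Φ = ≤-trans (≤-reflexive (sym (∑-*ʳ V M _))) (∑-mono V pointwise)
        where
        pointwise : ∀ w → heavy A w * M ≤ heavy A w * size A w
        pointwise w with M <? size A w
        ... | yes lt = *-monoʳ-≤ 1 (<⇒≤ lt)
        ... | no  _  = z≤n

      ∑y≡∑gain : ∑ U (λ v → ∑ V (λ a → ∑ V (y v a))) ≡ ∑ V (λ a → heavy A a * gain a)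
      ∑y≡∑gain = trans (∑-swap U V _) (∑-cong V (λ a → trans (∑-swap U V _)
        (trans (∑-cong V (λ w → ∑-*ˡ U (heavy A a) _)) (∑-*ˡ V (heavy A a) _))))

      -- Averaging: by Cauchy-Schwarz over the at most `s * M` elements of `U`, the `W` heavy
      -- vertices together gain enough to bound `Φ²`. The best gain bounds each of them, and
      -- `W * M ≤ Φ A` trades `W` and `M` for a factor `Φ A`, to be cancelled.
      Φ²≤ : ∀ {a} → (∀ a′ → gain a′ ≤ gain a) → Φ A * Φ A ≤ Φ A * (2 * s * gain a)
      Φ²≤ {a} best = begin
        Φ A * Φ A
          ≡⟨ cong₂ _*_ Φ≡∑b Φ≡∑b ⟩
        ∑ U b * ∑ U b
          ≤⟨ cauchy-schwarz U b ⟩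
        length U * ∑ U (λ v → b v * b v)
          ≤⟨ *-mono-≤ small (≤-trans (∑-mono U b²≤) (≤-reflexive (∑-*ˡ U 2 _))) ⟩
        s * M * (2 * ∑ U (λ v → ∑ V (λ a → ∑ V (y v a))))
          ≡⟨ cong (λ z → s * M * (2 * z)) ∑y≡∑gain ⟩
        s * M * (2 * ∑ V (λ a → heavy A a * gain a))
          ≤⟨ *-monoʳ-≤ (s * M) (*-monoʳ-≤ 2 (≤-trans (∑-mono V (λ a′ → *-monoʳ-≤ (heavy A a′) (best a′)))
               (≤-reflexive (∑-*ʳ V (gain a) _)))) ⟩
        s * M * (2 * (W * gain a))
          ≡⟨ identity s M W (gain a) ⟩
        W * M * (2 * s * gain a)
          ≤⟨ *-monoˡ-≤ (2 * s * gain a) W*M≤Φ ⟩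
        Φ A * (2 * s * gain a) ∎
        where
        open ≤-Reasoning
        identity : ∀ s M W g → s * M * (2 * (W * g)) ≡ W * M * (2 * s * g)
        identity = solve-∀

      good-centre : 0 < Φ A → ∃[ a ] ∃[ g ] (Φ A ≤ 2 * s * g × Φ (a ∷ A) + g ≤ Φ A)
      -- `w` is only the default of the maximum; a positive potential guarantees that a vertex
      -- exists.
      good-centre pos with w , _ ← ∑-pos V {λ w → heavy A w * size A w} pos = a , gain a , Φ≤gain , Φ-decrease a
        where
        best = maximiser gain w V
        a = proj₁ best
        Φ≤gain : Φ A ≤ 2 * s * gain a
        Φ≤gain = *-cancelˡ-≤ {Φ A} {2 * s * gain a} (Φ A) {{>-nonZero pos}}
          (Φ²≤ {a} (λ a′ → proj₂ best (∈-allFin a′)))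

    Φ≤ : length U ≤ n → ∀ A → Φ A ≤ n * n
    Φ≤ lenU A = begin
      Φ A                ≤⟨ ∑-bound V (λ w → ≤-trans (*-mono-≤ (𝟙≤1 (M <? size A w)) (size≤ w)) (≤-reflexive (*-identityˡ n))) ⟩
      length V * n       ≡⟨ cong (_* n) (length-tabulate {n = n} id) ⟩
      n * n              ∎
      where
      open ≤-Reasoning
      size≤ : ∀ w → size A w ≤ n
      size≤ w = ≤-trans (∑-bound U (λ v → 𝟙≤1 (near? A w v)))
        (≤-trans (≤-reflexive (*-identityʳ _)) lenU)

    Φ≡0⇒small : ∀ A → Φ A ≡ 0 → ∀ w → length (cluster A U w) ≤ M
    Φ≡0⇒small A Φ≡0 w = subst (_≤ M) (sym (length-filter≡∑ (near? A w) U)) (≮⇒≥ not-heavy)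
      where
      not-heavy : ¬ M < size A w
      not-heavy big = <⇒≱ (≤-<-trans z≤n big) (begin
        size A w                 ≡⟨ *-identityˡ (size A w) ⟨
        1 * size A w             ≡⟨ cong (_* size A w) (𝟙-yes (M <? size A w) big) ⟨
        heavy A w * size A w     ≤⟨ ∑-∈ (λ w → heavy A w * size A w) (∈-allFin w) ⟩
        Φ A                      ≡⟨ Φ≡0 ⟩
        0                        ∎)
        where open ≤-Reasoning

    -- Each greedy centre removes a fraction `1 / (2 * s)` of a potential below `2 ^ J`. The extra
    -- centre `a₀` keeps the list nonempty, so that nearest centres exist.
    centres : ∀ a₀ J → .{{NonZero s}} → length U ≤ n → n * n < 2 ^ J →
      ∃[ A ] (length A ≤ suc (2 * s * J) × a₀ ∈ A × (∀ w → length (cluster A U w) ≤ M))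
    centres a₀ J lenU lt =
      let start = steps-start {2 * s} {Φ (a₀ ∷ [])} {J} {{m*n≢0 2 s}} (≤-<-trans (Φ≤ lenU (a₀ ∷ [])) lt)
          A , len , sub , Φ≡0 = exhaust Φ (2 * s) Step.good-centre (2 * s * J) (a₀ ∷ []) start
      in A , len , sub (here refl) , Φ≡0⇒small A Φ≡0

-- Certificates for general graphs

certificateSize : (B s k : ℕ) → ℕ
certificateSize B s zero    = 0
certificateSize B s (suc k) = B * (s ^ suc k + certificateSize B s k)

module GeneralCertificate {n Δ : ℕ} (K : Known n Δ) (s J B : ℕ) (n²<2^J : n * n < 2 ^ J)
  (branching≤B : suc (2 * s * J) * suc Δ * suc Δ ≤ B) where
  open Known K renaming (edgeSet to E)
  open Metric K
  open Centres K

  module _ (A : List (Fin n)) where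

    pivots : List (Fin n)
    pivots = expand (expand A)

    length-pivots : length A ≤ suc (2 * s * J) → length pivots ≤ B
    length-pivots lenA = begin
      length pivots                        ≤⟨ length-expand (expand A) ⟩
      length (expand A) * suc Δ            ≤⟨ *-monoˡ-≤ (suc Δ) (length-expand A) ⟩
      length A * suc Δ * suc Δ             ≤⟨ *-monoˡ-≤ (suc Δ) (*-monoˡ-≤ (suc Δ) lenA) ⟩
      suc (2 * s * J) * suc Δ * suc Δ      ≤⟨ branching≤B ⟩
      B                                    ∎
      where open ≤-Reasoning

    Covered : Fin n → Fin n → Set
    Covered u v = ∃[ b ] (b ∈ pivots × (Resolves E (b , v) u v ⊎ Resolves E (b , u) u v ⊎ (Near A b u × Near A b v)))

    covered-sym : ∀ {u v} → Covered u v → Covered v u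
    covered-sym (b , i , inj₁ r)               = b , i , inj₂ (inj₁ (resolves-sym {E = E} r))
    covered-sym (b , i , inj₂ (inj₁ r))        = b , i , inj₁ (resolves-sym {E = E} r)
    covered-sym (b , i , inj₂ (inj₂ (p , q))) = b , i , inj₂ (inj₂ (q , p))

    -- If u is at least as close to the centres as v, let b be the vertex at
    -- distance 2 from the nearest centre a on a shortest path from a to u.
    -- Unless b resolves {u , v}, it is nearer to both than any centre.
    covered-ordered : ∀ {a u v} → u ≢ v → ¬ Edge E u v → a ∈ A →
      (∀ {a′} → a′ ∈ A → d a u ≤ d a′ u) → (∀ {a′} → a′ ∈ A → d a u ≤ d a′ v) → Covered u v
    covered-ordered {a} {u} {v} u≢v ¬e i mu mv with d a u in eq
    -- If `d a u` is 0 or 1, there is no vertex two steps along the path, but then `u` is itself a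
    -- pivot and the query to the pair settles it.
    ... | 0 with refl ← d≡0⇒≡ eq =
      u , ⊆-expand (⊆-expand i) , inj₁ (self-resolves u≢v ¬e)
    ... | suc r with w , e , eq₁ ← d-next eq | r
    ...   | 0 with refl ← d≡0⇒≡ eq₁ =
      u , ⊆-expand (edge-expand i e) , inj₁ (self-resolves u≢v ¬e)
    ...   | suc r′ with b , e′ , refl ← d-next eq₁ | suc (d b u) <? d b v
    ...     | yes lt = b , edge-expand (edge-expand i e) e′ , inj₁ (inj₁ (refl , lt))
    ...     | no ¬lt = b , edge-expand (edge-expand i e) e′ , inj₂ (inj₂
      ( All.tabulate (λ j → <-≤-trans (s≤s (n≤1+n _)) (mu j))
      -- This is where two steps are needed: `d b v ≤ d b u + 1 < d b u + 2 = d a u`, which is at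
      -- most the distance of any centre to `v`.
      , All.tabulate (λ j → <-≤-trans (s≤s (≮⇒≥ ¬lt)) (mv j))))

    covered : ∀ {a₀ u v} → a₀ ∈ A → u ≢ v → ¬ Edge E u v → Covered u v
    covered {u = u} {v} i₀ u≢v ¬e
      with a , i , mu ← minimiser (λ a → d a u) A i₀ | a′ , i′ , mv ← minimiser (λ a → d a v) A i₀
      with ≤-total (d a u) (d a′ v)
    ... | inj₁ le = covered-ordered u≢v ¬e i mu (λ j → ≤-trans le (mv j))
    ... | inj₂ le = covered-sym (covered-ordered (u≢v ∘ sym) (¬e ∘ symmetric) i′ mv (λ j → ≤-trans le (mu j)))

  Resolved : List (Fin n) → List (Fin n × Fin n) → Set
  Resolved U Q = ∀ {u v} → u ∈ U → v ∈ U → u ≢ v → ¬ Edge E u v → ∃[ pq ] (pq ∈ Q × Resolves E pq u v)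

  module Extend (U A : List (Fin n)) {a₀ : Fin n} (a₀∈A : a₀ ∈ A) (lenA : length A ≤ suc (2 * s * J))
    {S F : ℕ} (lenU : length U ≤ S)
    (sub : ∀ b → ∃[ qs ] (length qs ≤ F × Resolved (cluster A U b) qs)) where

    part : Fin n → List (Fin n × Fin n)
    part b = map (b ,_) U ++ proj₁ (sub b)

    qs : List (Fin n × Fin n)
    qs = concatMap part (pivots A)

    length-part : ∀ b → length (part b) ≤ S + F
    length-part b = ≤-trans (≤-reflexive (length-++ (map (b ,_) U)))
      (+-mono-≤ (≤-trans (≤-reflexive (length-map (b ,_) U)) lenU) (proj₁ (proj₂ (sub b))))

    length-qs : length qs ≤ B * (S + F)
    length-qs = ≤-trans (length-concatMap part length-part (pivots A))
      (*-monoˡ-≤ (S + F) (length-pivots A lenA))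

    resolved : Resolved U qs
    resolved {u} {v} i j u≢v ¬e with covered A a₀∈A u≢v ¬e
    ... | b , ib , inj₁ r = (b , v) , ∈-concatMap part ib (∈-++⁺ˡ (∈-map⁺ (b ,_) j)) , r
    ... | b , ib , inj₂ (inj₁ r) = (b , u) , ∈-concatMap part ib (∈-++⁺ˡ (∈-map⁺ (b ,_) i)) , r
    ... | b , ib , inj₂ (inj₂ (nu , nv))
      with pq , ipq , r ← proj₂ (proj₂ (sub b)) (∈-filter⁺ (near? A b) i nu) (∈-filter⁺ (near? A b) j nv) u≢v ¬e =
      pq , ∈-concatMap part ib (∈-++⁺ʳ (map (b ,_) U) ipq) , r

  certificate-within : .{{_ : NonZero s}} → ∀ k U → length U ≤ n → length U ≤ s ^ k →
    ∃[ qs ] (length qs ≤ certificateSize B s k × Resolved U qs)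
  certificate-within k       []            _   _   = [] , z≤n , λ ()
  certificate-within zero    (x ∷ [])      _   _   = [] , z≤n , λ where
    (here refl) (here refl) u≢u → contradiction refl u≢u
  certificate-within zero    (_ ∷ _ ∷ _)   _   (s≤s ())
  certificate-within (suc k) U@(a₀ ∷ _) l≤n l≤s =
    let A , lenA , a₀∈A , small = centres U (s ^ k) s l≤s a₀ J l≤n n²<2^J
        sub = λ b → certificate-within k (cluster A U b) (≤-trans (length-filter (near? A b) U) l≤n) (small b)
    in Extend.qs U A a₀∈A lenA l≤s sub , Extend.length-qs U A a₀∈A lenA l≤s sub , Extend.resolved U A a₀∈A lenA l≤s sub

  certificate : .{{_ : NonZero s}} → ∀ k → n ≤ s ^ k → ∃[ qs ] (length qs ≤ certificateSize B s k × Certificate E qs)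
  certificate k le
    with qs , len , res ← certificate-within k (allFin n) (≤-reflexive (length-tabulate {n = n} id))
                           (≤-trans (≤-reflexive (length-tabulate {n = n} id)) le) =
    qs , len , λ u v → res (∈-allFin u) (∈-allFin v)

-- Centroids of trees

does⁺ : (p : Dec P) → P → T (does p)
does⁺ (yes _) _ = _
does⁺ (no ¬p) p = ¬p p

does⁻ : (p : Dec P) → T (does p) → P
does⁻ (yes p) _ = p

_∋_ : Subset n → Fin n → Set
U ∋ v = T (Vec.lookup U v)

_∋?_ : (U : Subset n) (v : Fin n) → Dec (U ∋ v)
U ∋? v = T? (Vec.lookup U v)

comprehension : {P : Fin n → Set} → (∀ v → Dec (P v)) → Subset n
comprehension P? = Vec.tabulate (λ v → does (P? v))

∋-comprehension⁺ : {P : Fin n → Set} (P? : ∀ v → Dec (P v)) {v : Fin n} → P v → comprehension P? ∋ v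
∋-comprehension⁺ P? {v} p = subst T (sym (Vec.lookup∘tabulate _ v)) (does⁺ (P? v) p)

∋-comprehension⁻ : {P : Fin n → Set} (P? : ∀ v → Dec (P v)) {v : Fin n} → comprehension P? ∋ v → P v
∋-comprehension⁻ P? {v} i = does⁻ (P? v) (subst T (Vec.lookup∘tabulate _ v) i)

card : Subset n → ℕ
card U = ∑ (allFin _) (λ v → 𝟙 (U ∋? v))

simplePath-long : ∀ {R : A → A → Set} {u v} → u ≢ v → ¬ R u v → ∀ p → SimplePath R u v p → 3 ≤ length p
simplePath-long u≢v ¬r (_ ∷ [])         (refl , refl , _)         = contradiction refl u≢v
simplePath-long u≢v ¬r (_ ∷ _ ∷ [])     (refl , refl , r ∷ _ , _) = contradiction r ¬r
simplePath-long u≢v ¬r (_ ∷ _ ∷ _ ∷ _)  _                         = s≤s (s≤s (s≤s z≤n))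

module Tree {N : ℕ} (𝕋 : Graph N) (isTree : IsTree 𝕋) where

  CutEdge : Fin N → Fin N → Fin N → Set
  CutEdge t x y = Adj 𝕋 x y × x ≢ t × y ≢ t

  cutEdge? : ∀ t x y → Dec (CutEdge t x y)
  cutEdge? t x y = T? (edges 𝕋 x y) ×-dec ¬? (x ≟ t) ×-dec ¬? (y ≟ t)

  -- The components of the tree after deletion of `t`, with `t` as a class of its own.
  Joined : Fin N → Fin N → Fin N → Set
  Joined t = Star (CutEdge t)

  joined? : ∀ t x y → Dec (Joined t x y)
  joined? t x y with star? (λ x y → does (cutEdge? t x y)) x y
  ... | yes s = yes (Star.map (λ {x} {y} → does⁻ (cutEdge? t x y)) s)
  ... | no ¬s = no λ s → ¬s (Star.map (λ {x} {y} → does⁺ (cutEdge? t x y)) s)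

  joined-sym : ∀ {t x y} → Joined t x y → Joined t y x
  joined-sym = Star.reverse λ (e , x≢t , y≢t) → Graph.sym 𝕋 _ _ e , y≢t , x≢t

  ¬joined-centre : ∀ {t x} → x ≢ t → ¬ Joined t x t
  ¬joined-centre x≢t ε                         = x≢t refl
  ¬joined-centre x≢t ((_ , _ , y≢t) ◅ s)       = ¬joined-centre y≢t s

  last-before : ∀ {t x} → Star (Adj 𝕋) x t → x ≢ t → ∃[ t′ ] (Joined t x t′ × Adj 𝕋 t′ t)
  last-before ε x≢t = contradiction refl x≢t
  last-before {t} {x} (_◅_ {j = y} e s) x≢t with y ≟ t
  ... | yes refl = x , ε , e
  ... | no y≢t with t′ , j , a ← last-before s y≢t = t′ , (e , x≢t , y≢t) ◅ j , a

  -- If the walk met `t`, its initial part would join `z` to `t` without `t′`.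
  avoid : ∀ {t t′ z x} → ¬ Joined t′ z t → Joined t′ z x → Joined t z x
  avoid ¬j ε = ε
  avoid {t} {t′} {z} ¬j (_◅_ {j = y} c@(e , _ , _) s) =
    (e , (λ { refl → ¬j ε }) , (λ { refl → ¬j (c ◅ ε) })) ◅ avoid (λ j → ¬j (c ◅ j)) s

  -- The two walks would close the edge between t and t′ to a cycle.
  separate : ∀ {t t′ z} → Adj 𝕋 t′ t → Joined t′ z t → ¬ Joined t z t′
  separate {t} {t′} {z} e j₁ j₂ =
    proj₂ isTree t t′ p (h , l , Linked.map proj₁ es , un) (simplePath-long t≢t′ ¬r p sp) e
    where
    -- Adjacency without the edge between `t` and `t′`: a simple path in `R` between them is not
    -- that edge, so it has at least three vertices.
    R : Fin N → Fin N → Set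
    R x y = Adj 𝕋 x y × ¬ (x ≡ t × y ≡ t′) × ¬ (x ≡ t′ × y ≡ t)
    ¬r : ¬ R t t′
    ¬r (_ , ¬p , _) = ¬p (refl , refl)
    t≢t′ : t ≢ t′
    t≢t′ refl = irrefl 𝕋 t e
    star : Star R t t′
    star = Star.map (λ (e , x≢ , y≢) → e , (λ (_ , q) → y≢ q) , (λ (q , _) → x≢ q)) (joined-sym j₁)
        ◅◅ Star.map (λ (e , x≢ , y≢) → e , (λ (q , _) → x≢ q) , (λ (_ , q) → y≢ q)) j₂
    path = walk⇒simplePath (proj₂ (star⇒walk star))
    p = proj₁ path
    sp : SimplePath R t t′ p
    sp = proj₁ (proj₂ path)
    h = proj₁ sp
    l = proj₁ (proj₂ sp)
    es = proj₁ (proj₂ (proj₂ sp))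
    un = proj₂ (proj₂ (proj₂ sp))

  module _ {n : ℕ} (home : Fin n → Fin N) where

    InSide : Subset n → Fin N → Fin N → Fin n → Set
    InSide U t r v = U ∋ v × Joined t r (home v)

    inSide? : ∀ U t r v → Dec (InSide U t r v)
    inSide? U t r v = (U ∋? v) ×-dec joined? t r (home v)

    side : Subset n → Fin N → Fin N → Subset n
    side U t r = comprehension (inSide? U t r)

    -- An equality of subsets, not just two inclusions: two vertices in one component then get the
    -- same part, and so the same pivots further down the recursion.
    side-cong : ∀ U {t r r′} → Joined t r r′ → side U t r ≡ side U t r′
    side-cong U {t} {r} {r′} j = Vec.tabulate-cong λ v → does-⇔
      (mk⇔ (λ (i , k) → i , joined-sym j ◅◅ k) (λ (i , k) → i , j ◅◅ k))
      (inSide? U t r v) (inSide? U t r′ v)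

    Heavy : Subset n → Fin N → Fin N → Set
    Heavy U t r = r ≢ t × card U < 2 * card (side U t r)

    heavy? : ∀ U t r → Dec (Heavy U t r)
    heavy? U t r = ¬? (r ≟ t) ×-dec (card U <? 2 * card (side U t r))

    -- Two subsets that each hold more than half of `U` cannot be disjoint.
    heavy-meet : ∀ {U t r t′ r′} → Heavy U t r → Heavy U t′ r′ →
      ∃[ z ] (Joined t r z × Joined t′ r′ z)
    heavy-meet {U} {t} {r} {t′} {r′} (_ , h) (_ , h′)
      with any? (λ v → (side U t r ∋? v) ×-dec (side U t′ r′ ∋? v))
    ... | yes (v , i , i′) = home v , proj₂ (∋-comprehension⁻ (inSide? U t r) i) , proj₂ (∋-comprehension⁻ (inSide? U t′ r′) i′)
    ... | no disjoint = ⊥-elim (<-irrefl refl (begin-strict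
      c + c                                             <⟨ +-mono-< h h′ ⟩
      2 * c₁ + 2 * c₂                                   ≡⟨ *-distribˡ-+ 2 c₁ c₂ ⟨
      2 * (c₁ + c₂)                                     ≤⟨ *-monoʳ-≤ 2 sum≤ ⟩
      2 * c                                             ≡⟨ cong (c +_) (+-identityʳ c) ⟩
      c + c                                             ∎))
      where
      open ≤-Reasoning
      c = card U
      c₁ = card (side U t r)
      c₂ = card (side U t′ r′)
      sum≤ : c₁ + c₂ ≤ c
      sum≤ = ≤-trans (≤-reflexive (sym (∑-+ (allFin n) _ _)))
        (∑-mono (allFin n) λ v → 𝟙-disjoint (side U t r ∋? v) (side U t′ r′ ∋? v) (U ∋? v)
          (λ i → proj₁ (∋-comprehension⁻ (inSide? U t r) i))
          (λ i → proj₁ (∋-comprehension⁻ (inSide? U t′ r′) i))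
          (λ i i′ → disjoint (v , i , i′)))

    -- The measure for the descent to the centroid. It counts tree nodes, since the number of
    -- elements of `U` on the heavy side may stay the same after a move.
    sideSize : Fin N → Fin N → ℕ
    sideSize t r = ∑ (allFin N) (λ x → 𝟙 (joined? t r x))

    -- The heavy sides share a node `z`, which reaches `t′` without `t`. If the new side contained
    -- `t`, then `z` would also reach `t` without `t′`, against `separate`. So the new side stays
    -- within the old one, and it lacks `t′`.
    side-shrinks : ∀ {U t r t′ r′} → Joined t r t′ → Adj 𝕋 t′ t → Heavy U t r → Heavy U t′ r′ →
      sideSize t′ r′ < sideSize t r
    side-shrinks {U} {t} {r} {t′} {r′} j e hv hv′ =
      ∑-strict (λ x → 𝟙-mono (joined? t′ r′ x) (joined? t r x) inside) (∈-allFin t′)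
        (subst₂ _<_ (sym (𝟙-no (joined? t′ r′ t′) (¬joined-centre (proj₁ hv′))))
          (sym (𝟙-yes (joined? t r t′) j)) z<s)
      where
      meet = heavy-meet {U} {t} {r} {t′} {r′} hv hv′
      z = proj₁ meet
      rz : Joined t r z
      rz = proj₁ (proj₂ meet)
      rz′ : Joined t′ r′ z
      rz′ = proj₂ (proj₂ meet)
      inside : ∀ {x} → Joined t′ r′ x → Joined t r x
      inside k = rz ◅◅ avoid (λ zt → separate e zt (joined-sym rz ◅◅ j)) (joined-sym rz′ ◅◅ k)

    Balanced : Subset n → Fin N → Set
    Balanced U t = ∀ r → r ≢ t → 2 * card (side U t r) ≤ card U

    balanced-or-heavy : ∀ U t → Balanced U t ⊎ ∃ (Heavy U t)
    balanced-or-heavy U t with any? (heavy? U t)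
    ... | yes h = inj₂ h
    ... | no ¬h = inj₁ λ r r≢t → ≮⇒≥ λ lt → ¬h (r , r≢t , lt)

    descend : ∀ U k t r → Heavy U t r → sideSize t r ≤ k → ∃ (Balanced U)
    descend U k t r hv le with last-before (proj₁ isTree r t) (proj₁ hv)
    ... | t′ , j , e with balanced-or-heavy U t′ | k
    ...   | inj₁ bal        | _      = t′ , bal
    ...   | inj₂ (r′ , hv′) | zero   = contradiction (<-≤-trans (side-shrinks {U} j e hv hv′) le) λ ()
    ...   | inj₂ (r′ , hv′) | suc k′ = descend U k′ t′ r′ hv′ (s≤s⁻¹ (<-≤-trans (side-shrinks {U} j e hv hv′) le))

    centroid : ∀ U → Fin N → ∃ (Balanced U)
    centroid U t with balanced-or-heavy U t
    ... | inj₁ bal      = t , bal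
    ... | inj₂ (r , hv) = descend U _ t r hv ≤-refl

-- Certificates from tree decompositions

∑-tabulate : ∀ {m} (g : Fin m → A) (f : A → ℕ) → ∑ (tabulate g) f ≡ ∑ (allFin m) (λ i → f (g i))
∑-tabulate {m = zero}  g f = refl
∑-tabulate {m = suc m} g f = cong (f (g Fin.zero) +_)
  (trans (∑-tabulate (g ∘ Fin.suc) f) (sym (∑-tabulate Fin.suc (f ∘ g))))

∣tabulate∣≡∑ : ∀ {n} (f : Fin n → Bool) → ∣ Vec.tabulate f ∣ ≡ ∑ (allFin n) (λ v → 𝟙 (T? (f v)))
∣tabulate∣≡∑ {zero}  f = refl
∣tabulate∣≡∑ {suc n} f = trans (head+ (f Fin.zero))
  (cong (𝟙 (T? (f Fin.zero)) +_)
    (trans (∣tabulate∣≡∑ (f ∘ Fin.suc)) (sym (∑-tabulate Fin.suc (λ v → 𝟙 (T? (f v)))))))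
  where
  head+ : ∀ b → ∣ b Vec.∷ Vec.tabulate (f ∘ Fin.suc) ∣ ≡ 𝟙 (T? b) + ∣ Vec.tabulate (f ∘ Fin.suc) ∣
  head+ true  = refl
  head+ false = refl

∣∣≡card : (U : Subset n) → ∣ U ∣ ≡ card U
∣∣≡card U = trans (cong ∣_∣ (sym (Vec.tabulate∘lookup U))) (∣tabulate∣≡∑ (Vec.lookup U))

∈⇒∋ : {U : Subset n} {v : Fin n} → v Subset.∈ U → U ∋ v
∈⇒∋ i = subst T (sym (Vec.[]=⇒lookup i)) _

∋⇒∈ : (U : Subset n) (v : Fin n) → U ∋ v → v Subset.∈ U
∋⇒∈ U v i with Vec.lookup U v in eq
... | true = Vec.lookup⇒[]= v U eq

full : Subset n
full = Vec.tabulate (λ _ → true)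

≤max : (xs : List ℕ) {x : ℕ} → x ∈ xs → x ≤ max 0 xs
≤max xs = All.lookup (xs≤max 0 xs)

module TreeCertificate {n Δ : ℕ} (K : Known n Δ) {G : Graph n} (D : TreeDecomposition G)
  (known⊆G : ∀ {u v} → Edge (Known.edgeSet K) u v → Adj G u v) (t₀ : Fin (TreeDecomposition.nodes D)) where
  open Known K renaming (edgeSet to E)
  open Metric K
  open TreeDecomposition D hiding (width)
  open Tree tree isTree

  home : Fin n → Fin nodes
  home v = proj₁ (coversVertex v)

  home∋ : ∀ v → bag (home v) ∋ v
  home∋ v = ∈⇒∋ (proj₂ (coversVertex v))

  -- By coherence every bag on the tree path from `r` to `s` contains `x`, so the path misses `t`.
  bags-joined : ∀ {t x r s} → ¬ bag t ∋ x → bag r ∋ x → bag s ∋ x → Joined t r s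
  bags-joined {t} {x} {r} {s} ¬i ir is =
    walk⇒star (linked⇒walk p (proj₁ sp) (proj₁ (proj₂ sp))
      (cut p (proj₁ (proj₂ (proj₂ sp))) (coherent x r s p (∋⇒∈ (bag r) x ir) (∋⇒∈ (bag s) x is) sp)))
    where
    path = walk⇒simplePath (proj₂ (star⇒walk (proj₁ isTree r s)))
    p = proj₁ path
    sp : IsPath tree r s p
    sp = proj₁ (proj₂ path)
    ≢t : ∀ {y} → x Subset.∈ bag y → y ≢ t
    ≢t i refl = ¬i (∈⇒∋ i)
    cut : ∀ p → Linked (Adj tree) p → All (λ y → x Subset.∈ bag y) p → Linked (CutEdge t) p
    cut []          _        _              = []
    cut (_ ∷ [])    _        _              = [-]
    cut (_ ∷ y ∷ p) (e ∷ es) (i ∷ i′ ∷ is) = (e , ≢t i , ≢t i′) ∷ cut (y ∷ p) es (i′ ∷ is)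

  edge-joined : ∀ {t x y} → Edge E x y → ¬ bag t ∋ x → ¬ bag t ∋ y → Joined t (home x) (home y)
  edge-joined {t} {x} {y} e ¬x ¬y with r , ix , iy ← coversEdge x y (known⊆G e) =
    bags-joined ¬x (home∋ x) (∈⇒∋ ix) ◅◅ bags-joined ¬y (∈⇒∋ iy) (home∋ y)

  module _ (t : Fin nodes) where

    -- Along a geodesic from `x` to `v` the component of the home cannot change without a vertex of
    -- the bag. As `x` lies outside the bag, that vertex comes later and is strictly nearer to `v`.
    meets-bag : ∀ m {x v} → d x v ≡ m → ¬ bag t ∋ x → ¬ Joined t (home x) (home v) →
      ∃[ s ] (bag t ∋ s × d s v < m)
    meets-bag zero    eq ¬x ¬j with refl ← d≡0⇒≡ eq = contradiction ε ¬j
    meets-bag (suc m) eq ¬x ¬j with y , e , eq′ ← d-next eq with bag t ∋? y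
    ... | yes i = y , i , s≤s (≤-reflexive eq′)
    ... | no ¬y with s , i , lt ← meets-bag m eq′ ¬y (λ j → ¬j (edge-joined e ¬x ¬y ◅◅ j)) =
      s , i , m<n⇒m<1+n lt

    -- Vertices of a geodesic to `u` only come nearer to `u`, so none of them is in the bag, and its
    -- edges stay in one component.
    close-joined : ∀ m {x u} → d x u ≡ m → (∀ {s} → bag t ∋ s → m < d s u) → Joined t (home x) (home u)
    close-joined zero    eq far with refl ← d≡0⇒≡ eq = ε
    close-joined (suc m) eq far with y , e , eq′ ← d-next eq =
      edge-joined e (λ i → <-irrefl (sym eq) (far i)) (λ i → <-asym (far i) (s≤s (≤-reflexive eq′)))
        ◅◅ close-joined m eq′ (λ i → <-trans (n<1+n m) (far i))

    separator : List (Fin n)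
    separator = filter (bag t ∋?_) (allFin n)

    pivots : List (Fin n)
    pivots = expand separator

    ∈-separator : ∀ {s} → bag t ∋ s → s ∈ separator
    ∈-separator {s} i = ∈-filter⁺ (bag t ∋?_) (∈-allFin s) i

    separator-∈ : ∀ {s} → s ∈ separator → bag t ∋ s
    separator-∈ i = proj₂ (∈-filter⁻ (bag t ∋?_) {xs = allFin n} i)

    length-pivots : length pivots ≤ suc (width D) * suc Δ
    length-pivots = ≤-trans (length-expand separator) (*-monoˡ-≤ (suc Δ) (begin
      length separator  ≡⟨ trans (length-filter≡∑ (bag t ∋?_) (allFin n)) (sym (∣∣≡card (bag t))) ⟩
      ∣ bag t ∣         ≤⟨ ≤max (tabulate (λ t → ∣ bag t ∣)) (∈-tabulate⁺ {f = λ t → ∣ bag t ∣} t) ⟩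
      largest           ≤⟨ m≤n+m∸n largest 1 ⟩
      suc (width D)     ∎))
      where
      open ≤-Reasoning
      largest : ℕ
      largest = max 0 (tabulate (λ t → ∣ bag t ∣))

    Resolvable : Fin n → Fin n → Set
    Resolvable u v = ∃[ p ] (p ∈ pivots × (Resolves E (p , v) u v ⊎ Resolves E (p , u) u v))

    resolvable-sym : ∀ {u v} → Resolvable u v → Resolvable v u
    resolvable-sym (p , i , inj₁ r) = p , i , inj₂ (resolves-sym {E = E} r)
    resolvable-sym (p , i , inj₂ r) = p , i , inj₁ (resolves-sym {E = E} r)

    bag-resolvable : ∀ {u v} → u ≢ v → ¬ Edge E u v → bag t ∋ u → Resolvable u v
    bag-resolvable {u} u≢v ¬e i = u , ⊆-expand (∈-separator i) , inj₁ (self-resolves u≢v ¬e)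

    -- If u is at least as close to the bag as v, let b be the neighbour of the
    -- nearest bag vertex a on a shortest path from a to u.  That path avoids the
    -- bag, so every path from b to v enters the bag, and b is nearer to u by 2.
    separated-ordered : ∀ {a u v} → u ≢ v → ¬ Edge E u v → ¬ Joined t (home u) (home v) → a ∈ separator →
      (∀ {s} → s ∈ separator → d a u ≤ d s u) → (∀ {s} → s ∈ separator → d a u ≤ d s v) → Resolvable u v
    separated-ordered {a} {u} {v} u≢v ¬e ¬j i mu mv with d a u in eq
    ... | zero with refl ← d≡0⇒≡ eq = bag-resolvable u≢v ¬e (separator-∈ i)
    ... | suc m =
      let b , e , eq′ = d-next eq
          b∉ = λ ib → <-irrefl (sym eq′) (mu (∈-separator ib))
          b~u = close-joined m eq′ (λ is → mu (∈-separator is))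
          s , is , lt = meets-bag (d b v) refl b∉ (λ bv → ¬j (joined-sym b~u ◅◅ bv))
      in b , edge-expand i e , inj₁ (inj₁ (refl , ≤-<-trans (s≤s (≤-reflexive eq′)) (≤-<-trans (mv (∈-separator is)) lt)))

    separated : ∀ {u v} → u ≢ v → ¬ Edge E u v → ¬ bag t ∋ u → ¬ Joined t (home u) (home v) → Resolvable u v
    separated {u} {v} u≢v ¬e ¬u ¬j
      -- This vertex only shows that the separator is nonempty, so that nearest bag vertices exist.
      with s₀ , is₀ , _ ← meets-bag (d u v) refl ¬u ¬j
      with a , i , mu ← minimiser (λ a → d a u) separator (∈-separator is₀)
         | a′ , i′ , mv ← minimiser (λ a → d a v) separator (∈-separator is₀)
      with ≤-total (d a u) (d a′ v)
    ... | inj₁ le = separated-ordered u≢v ¬e ¬j i mu (λ j → ≤-trans le (mv j))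
    ... | inj₂ le = resolvable-sym
      (separated-ordered (u≢v ∘ sym) (¬e ∘ symmetric) (¬j ∘ joined-sym) i′ mv (λ j → ≤-trans le (mu j)))

    resolvable-or-joined : ∀ {u v} → u ≢ v → ¬ Edge E u v →
      Resolvable u v ⊎ (home u ≢ t × Joined t (home u) (home v))
    resolvable-or-joined {u} {v} u≢v ¬e with bag t ∋? u
    ... | yes i = inj₁ (bag-resolvable u≢v ¬e i)
    ... | no ¬u with joined? t (home u) (home v)
    ...   | yes j = inj₂ ((λ eq → ¬u (subst (λ r → bag r ∋ u) eq (home∋ u))) , j)
    ...   | no ¬j = inj₁ (separated u≢v ¬e ¬u ¬j)

  middle : Subset n → Fin nodes
  middle U = proj₁ (centroid home U t₀)

  part : Subset n → Fin n → Subset n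
  part U v = side home U (middle U) (home v)

  -- The pivots are collected for each target `v` along the branch of parts that contain it. So `v`
  -- meets one separator per level, however many parts there are.
  allPivots : ℕ → Subset n → Fin n → List (Fin n)
  allPivots zero    U v = []
  allPivots (suc j) U v = pivots (middle U) ++ allPivots j (part U v) v

  length-allPivots : ∀ j U v → length (allPivots j U v) ≤ j * (suc (width D) * suc Δ)
  length-allPivots zero    U v = z≤n
  length-allPivots (suc j) U v = ≤-trans (≤-reflexive (length-++ (pivots (middle U))))
    (+-mono-≤ (length-pivots (middle U)) (length-allPivots j (part U v) v))

  middle-balanced : ∀ U → Balanced home U (middle U)
  middle-balanced U = proj₂ (centroid home U t₀)

  part-halves : ∀ U u j → home u ≢ middle U → card U < 2 ^ suc j → card (part U u) < 2 ^ j
  part-halves U u j h≢ lt = *-cancelˡ-< 2 (card (part U u)) (2 ^ j)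
    (≤-<-trans {2 * card (part U u)} {card U} {2 ^ suc j} (middle-balanced U (home u) h≢) lt)

  PivotsResolve : ℕ → Subset n → Fin n → Fin n → Set
  PivotsResolve j U u v = ∃[ p ] ((p ∈ allPivots j U v × Resolves E (p , v) u v)
                                ⊎ (p ∈ allPivots j U u × Resolves E (p , u) u v))

  resolve-directly : ∀ j U {u v} → Resolvable (middle U) u v → PivotsResolve (suc j) U u v
  resolve-directly j U (p , i , inj₁ r) = p , inj₁ (∈-++⁺ˡ i , r)
  resolve-directly j U (p , i , inj₂ r) = p , inj₂ (∈-++⁺ˡ i , r)

  resolve-in-part : ∀ j U {u v} → part U u ≡ part U v → PivotsResolve j (part U u) u v → PivotsResolve (suc j) U u v
  resolve-in-part j U {u} {v} eq (p , inj₁ (i , r)) =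
    p , inj₁ (∈-++⁺ʳ (pivots (middle U)) (subst (λ W → p ∈ allPivots j W v) eq i) , r)
  resolve-in-part j U {u} {v} eq (p , inj₂ (i , r)) = p , inj₂ (∈-++⁺ʳ (pivots (middle U)) i , r)

  ∋-part : ∀ {U u v} → U ∋ v → Joined (middle U) (home u) (home v) → part U u ∋ v
  ∋-part {U} {u} i j = ∋-comprehension⁺ (inSide? home U (middle U) (home u)) (i , j)

  pivots-resolve : ∀ j U {u v} → card U < 2 ^ j → U ∋ u → U ∋ v → u ≢ v → ¬ Edge E u v → PivotsResolve j U u v
  pivots-resolve zero U {u} lt iu _ _ _ = contradiction
    (≤-trans (≤-reflexive (sym (𝟙-yes (U ∋? u) iu))) (∑-∈ (λ v → 𝟙 (U ∋? v)) (∈-allFin u))) (<⇒≱ lt)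
  pivots-resolve (suc j) U {u} {v} lt iu iv u≢v ¬e = case resolvable-or-joined (middle U) u≢v ¬e of λ where
    (inj₁ r)        → resolve-directly j U r
    (inj₂ (h≢ , s)) → resolve-in-part j U (side-cong home U s)
      (pivots-resolve j (part U u) (part-halves U u j h≢ lt)
        (∋-part {U} {u} {u} iu ε) (∋-part {U} {u} {v} iv s) u≢v ¬e)

  certificate : ∀ J → n < 2 ^ J → ∃[ qs ] (length qs ≤ n * (J * (suc (width D) * suc Δ)) × Certificate E qs)
  certificate J n<2^J = qs , length-qs , certifies
    where
    queriesTo : Fin n → List (Fin n × Fin n)
    queriesTo v = map (_, v) (allPivots J full v)
    qs = concatMap queriesTo (allFin n)
    length-qs : length qs ≤ n * (J * (suc (width D) * suc Δ))
    length-qs = subst (λ l → length qs ≤ l * (J * (suc (width D) * suc Δ))) (length-tabulate {n = n} id)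
      (length-concatMap queriesTo (λ v → ≤-trans (≤-reflexive (length-map (_, v) (allPivots J full v)))
        (length-allPivots J full v)) (allFin n))
    card≤n : card (full {n}) ≤ n
    card≤n = ≤-trans (∑-bound (allFin n) (λ v → 𝟙≤1 (full {n} ∋? v)))
      (≤-reflexive (trans (*-identityʳ _) (length-tabulate {n = n} id)))
    full∋ : ∀ v → full {n} ∋ v
    full∋ v = subst T (sym (Vec.lookup∘tabulate (λ _ → true) v)) _
    certifies : Certificate E qs
    certifies u v u≢v ¬e with pivots-resolve J full (≤-<-trans card≤n n<2^J) (full∋ u) (full∋ v) u≢v ¬e
    ... | p , inj₁ (i , r) = (p , v) , ∈-concatMap queriesTo (∈-allFin v) (∈-map⁺ (_, v) i) , r
    ... | p , inj₂ (i , r) = (p , u) , ∈-concatMap queriesTo (∈-allFin u) (∈-map⁺ (_, u) i) , r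

-- The greedy algorithm

Consecutive : List A → A → A → Set
Consecutive []          _ _ = ⊥
Consecutive (_ ∷ [])    _ _ = ⊥
Consecutive (x ∷ y ∷ p) a b = (x ≡ a × y ≡ b) ⊎ Consecutive (y ∷ p) a b

consecutive? : (p : List (Fin n)) (a b : Fin n) → Dec (Consecutive p a b)
consecutive? []          a b = no λ ()
consecutive? (_ ∷ [])    a b = no λ ()
consecutive? (x ∷ y ∷ p) a b = ((x ≟ a) ×-dec (y ≟ b)) ⊎-dec consecutive? (y ∷ p) a b

linked-consecutive : ∀ {R : A → A → Set} {a b} p → Linked R p → Consecutive p a b → R a b
linked-consecutive (_ ∷ _ ∷ _) (e ∷ _)  (inj₁ (refl , refl)) = e
linked-consecutive (_ ∷ y ∷ p) (_ ∷ es) (inj₂ c)             = linked-consecutive (y ∷ p) es c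

linked-or-not : ∀ {R : A → A → Set} → (∀ a b → Dec (R a b)) → ∀ p →
  Linked R p ⊎ (∃[ a ] ∃[ b ] (Consecutive p a b × ¬ R a b))
linked-or-not R? []          = inj₁ []
linked-or-not R? (_ ∷ [])    = inj₁ [-]
linked-or-not R? (x ∷ y ∷ p) with R? x y | linked-or-not R? (y ∷ p)
... | no ¬r | _                        = inj₂ (x , y , inj₁ (refl , refl) , ¬r)
... | yes r | inj₁ es                  = inj₁ (r ∷ es)
... | yes r | inj₂ (a , b , c , ¬r)    = inj₂ (a , b , inj₂ c , ¬r)

∑-cartesianProduct : (xs : List A) (ys : List B) (f : A × B → ℕ) →
  ∑ (cartesianProduct xs ys) f ≡ ∑ xs (λ x → ∑ ys (λ y → f (x , y)))
∑-cartesianProduct []       ys f = refl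
∑-cartesianProduct (x ∷ xs) ys f = trans (∑-++ (map (x ,_) ys)) (cong₂ _+_ (∑-map ys) (∑-cartesianProduct xs ys f))
  where
  ∑-++ : ∀ zs {ws} → ∑ (zs ++ ws) f ≡ ∑ zs f + ∑ ws f
  ∑-++ []       = refl
  ∑-++ (z ∷ zs) = trans (cong (f z +_) (∑-++ zs)) (sym (+-assoc (f z) _ _))
  ∑-map : ∀ ys → ∑ (map (x ,_) ys) f ≡ ∑ ys (λ y → f (x , y))
  ∑-map []       = refl
  ∑-map (y ∷ ys) = cong (f (x , y) +_) (∑-map ys)

pairs : ∀ n → List (Fin n × Fin n)
pairs n = cartesianProduct (allFin n) (allFin n)

∈-pairs : (uv : Fin n × Fin n) → uv ∈ pairs n
∈-pairs (u , v) = ∈-cartesianProduct⁺ (∈-allFin u) (∈-allFin v)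

count : EdgeSet n → ℕ
count {n} E = ∑ (pairs n) (λ (u , v) → 𝟙 (T? (E u v)))

count-pos : (E : EdgeSet n) → ∀ {u v} → Edge E u v → 0 < count E
count-pos E {u} {v} e = ≤-trans (≤-reflexive (sym (𝟙-yes (T? (E u v)) e)))
  (∑-∈ (λ (u , v) → 𝟙 (T? (E u v))) (∈-pairs (u , v)))

count-rows : (E : EdgeSet n) → count E ≡ ∑ (allFin n) (λ u → length (neighbours E u))
count-rows {n} E = trans (∑-cartesianProduct (allFin n) (allFin n) _)
  (∑-cong (allFin n) (λ u → sym (length-filter≡∑ (λ v → T? (E u v)) (allFin n))))

count≤ : (E : EdgeSet n) {c : ℕ} → (∀ u → length (neighbours E u) ≤ c) → count E ≤ n * c
count≤ {n} E {c} h = ≤-trans (≤-reflexive (count-rows E))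
  (≤-trans (∑-bound (allFin n) h) (≤-reflexive (cong (_* c) (length-tabulate {n = n} id))))

neighbours≤n : (E : EdgeSet n) (u : Fin n) → length (neighbours E u) ≤ n
neighbours≤n {n} E u = ≤-trans (length-filter (λ v → T? (E u v)) (allFin n)) (≤-reflexive (length-tabulate {n = n} id))

count-mono : (E F : EdgeSet n) → (∀ {u v} → Edge E u v → Edge F u v) → count E ≤ count F
count-mono {n} E F h = ∑-mono (pairs n) (λ (u , v) → 𝟙-mono (T? (E u v)) (T? (F u v)) h)

count-strict : (E F : EdgeSet n) → (∀ {u v} → Edge E u v → Edge F u v) →
  ∀ {u v} → Edge F u v → ¬ Edge E u v → count E < count F
count-strict E F h {u} {v} f ¬e =
  ∑-strict (λ (u , v) → 𝟙-mono (T? (E u v)) (T? (F u v)) h) (∈-pairs (u , v))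
    (subst₂ _<_ (sym (𝟙-no (T? (E u v)) ¬e)) (sym (𝟙-yes (T? (F u v)) f)) z<s)

-- X holds the edges found so far and Z the ordered pairs still undecided.
module _ {n : ℕ} (X Z : EdgeSet n) where

  gain : Fin n × Fin n → ℕ
  gain pq = ∑ (pairs n) (λ (u , v) → 𝟙 (T? (Z u v) ×-dec resolves? X pq u v))

  Reachable : Set
  Reachable = ∀ p q → dist X n p q < n

  -- The chosen pair comes with the reason for its choice, either unreachability or maximal gain in
  -- a connected known graph.
  Choice : Set
  Choice = ∃[ pq ] (n ≤ dist X n (proj₁ pq) (proj₂ pq) ⊎ (Reachable × (∀ pq′ → gain pq′ ≤ gain pq)))

  choose : Fin n × Fin n → Choice
  choose uv with any? (λ p → any? (λ q → n ≤? dist X n p q))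
  ... | yes (p , q , le) = (p , q) , inj₁ le
  ... | no ¬le =
    proj₁ best , inj₂ ((λ p q → ≰⇒> λ le → ¬le (p , q , le)) , λ pq′ → proj₂ best {pq′} (∈-pairs pq′))
    where
    best : ∃[ pq ] (∀ {pq′} → pq′ ∈ pairs n → gain pq′ ≤ gain pq)
    best = maximiser gain uv (pairs n)

  undecided? : Dec (∃[ u ] ∃[ v ] Edge Z u v)
  undecided? = any? (λ u → any? (λ v → T? (Z u v)))

  module _ (pq : Fin n × Fin n) (π : List (Fin n)) where

    known? : ∀ u v → Dec (Edge X u v ⊎ Consecutive π u v ⊎ Consecutive π v u)
    known? u v = T? (X u v) ⊎-dec consecutive? π u v ⊎-dec consecutive? π v u

    nextX : EdgeSet n
    nextX u v = does (known? u v)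

    -- `length π` counts vertices, one more than edges, so the strict inequality says that the
    -- answer is no shorter than the known distance.
    Refuted : Fin n → Fin n → Set
    Refuted u v = dist X n (proj₁ pq) (proj₂ pq) < length π × Resolves X pq u v

    remains? : ∀ u v → Dec (Edge Z u v × ¬ Edge nextX u v × ¬ Refuted u v)
    remains? u v = T? (Z u v) ×-dec ¬? (T? (nextX u v)) ×-dec
      ¬? ((dist X n (proj₁ pq) (proj₂ pq) <? length π) ×-dec resolves? X pq u v)

    nextZ : EdgeSet n
    nextZ u v = does (remains? u v)

-- The first argument is fuel for termination. Starting it at `n * n` suffices, since every query
-- decides at least one ordered pair.
solve : ℕ → (X Z : EdgeSet n) → Algorithm n
solve zero    X Z = stop X
solve (suc k) X Z with undecided? X Z
... | no _ = stop X
... | yes (u , v , _) =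
  let pq , _ = choose X Z (u , v)
  in query (proj₁ pq) (proj₂ pq) (λ π → solve k (nextX X Z pq π) (nextZ X Z pq π))

noEdges : EdgeSet n
noEdges _ _ = false

distinct : EdgeSet n
distinct u v = does (¬? (u ≟ v))

reconstruct : (n : ℕ) → Algorithm n
reconstruct n = solve (n * n) noEdges distinct

-- Correctness and progress of a greedy step

T-ext : ∀ {a b} → (T a → T b) → (T b → T a) → a ≡ b
T-ext {false} {false} f g = refl
T-ext {false} {true}  f g = ⊥-elim (g _)
T-ext {true}  {false} f g = ⊥-elim (f _)
T-ext {true}  {true}  f g = refl

module Analysis {n : ℕ} {G : Graph n} (O : Oracle G) where
  open Oracle O

  record Invariant (X Z : EdgeSet n) : Set where
    field
      sound     : ∀ {u v} → Edge X u v → Adj G u v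
      symmetric : ∀ {u v} → Edge X u v → Edge X v u
      complete  : ∀ {u v} → Adj G u v → Edge X u v ⊎ Edge Z u v
      fresh     : ∀ {u v} → Edge Z u v → u ≢ v × ¬ Edge X u v

  initial : Invariant noEdges distinct
  initial = record
    { sound     = λ ()
    ; symmetric = λ ()
    ; complete  = λ {u} {v} e → inj₂ (does⁺ (¬? (u ≟ v)) (λ { refl → irrefl G u e }))
    ; fresh     = λ {u} {v} z → does⁻ (¬? (u ≟ v)) z , λ ()
    }

  answer≤walk : ∀ {m u v} → Walk (Adj G) m u v → length (answer u v) ≤ suc m
  answer≤walk {u = u} {v} w with p , sp , le ← walk⇒simplePath w = ≤-trans (proj₂ (shortest u v) p sp) le

  answer-linked : ∀ u v → Linked (Adj G) (answer u v)
  answer-linked u v = proj₁ (proj₂ (proj₂ (proj₁ (shortest u v))))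

  answer≤n : ∀ u v → length (answer u v) ≤ n
  answer≤n u v = unique-length (answer u v) (proj₂ (proj₂ (proj₂ (proj₁ (shortest u v)))))

  known-linked⇒dist< : ∀ X u v → Linked (Edge X) (answer u v) → dist X n u v < length (answer u v)
  known-linked⇒dist< X u v es = go (answer u v) (proj₁ (proj₁ (shortest u v))) (proj₁ (proj₂ (proj₁ (shortest u v)))) es
    where
    go : ∀ p → head p ≡ just u → last p ≡ just v → Linked (Edge X) p → dist X n u v < length p
    go p@(_ ∷ _) h l es = s≤s (dist≤walk X n (linked⇒walk p h l es))

  module _ {X Z : EdgeSet n} (I : Invariant X Z) where
    open Invariant I

    -- The edge would extend a known walk from `p` to `u` to a walk to `v` in `G` that is shorter
    -- than the oracle's shortest path.
    near-refutes : ∀ {p u v} → dist X n p v < length (answer p v) → suc (dist X n p u) < dist X n p v → ¬ Adj G u v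
    near-refutes {p} {u} {v} short lt e = <-irrefl refl (begin-strict
      length (answer p v)       ≤⟨ answer≤walk (walk-snoc (walk-map sound (dist-walk X n p u p-u<n)) e) ⟩
      suc (suc (dist X n p u))  ≤⟨ lt ⟩
      dist X n p v              <⟨ short ⟩
      length (answer p v)       ∎)
      where
      open ≤-Reasoning
      p-u<n : dist X n p u < n
      -- Below the truncation value, `dist X n p u` is the length of an actual walk.
      p-u<n = <-≤-trans (<-trans (n<1+n _) lt) (dist≤ X n p v)

    refuted : ∀ pq {u v} → Refuted X Z pq (answer (proj₁ pq) (proj₂ pq)) u v → ¬ Adj G u v
    refuted (p , q) (short , inj₁ (refl , lt)) e = near-refutes short lt e
    refuted (p , q) (short , inj₂ (refl , lt)) e = near-refutes short lt (Graph.sym G _ _ e)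

    module _ (pq : Fin n × Fin n) where

      π : List (Fin n)
      π = answer (proj₁ pq) (proj₂ pq)

      X′ Z′ : EdgeSet n
      X′ = nextX X Z pq π
      Z′ = nextZ X Z pq π

      nextX⁻ : ∀ {u v} → Edge X′ u v → Edge X u v ⊎ Consecutive π u v ⊎ Consecutive π v u
      nextX⁻ {u} {v} = does⁻ (known? X Z pq π u v)

      nextX⁺ : ∀ {u v} → Edge X u v ⊎ Consecutive π u v ⊎ Consecutive π v u → Edge X′ u v
      nextX⁺ {u} {v} = does⁺ (known? X Z pq π u v)

      nextZ⁻ : ∀ {u v} → Edge Z′ u v → Edge Z u v × ¬ Edge X′ u v × ¬ Refuted X Z pq π u v
      nextZ⁻ {u} {v} = does⁻ (remains? X Z pq π u v)

      consecutive-adjacent : ∀ {u v} → Consecutive π u v → Adj G u v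
      consecutive-adjacent = linked-consecutive π (answer-linked _ _)

      invariant-next : Invariant X′ Z′
      invariant-next = record
        { sound     = sound′
        ; symmetric = symmetric′
        ; complete  = complete′
        ; fresh     = λ z → proj₁ (fresh (proj₁ (nextZ⁻ z))) , proj₁ (proj₂ (nextZ⁻ z))
        }
        where
        sound′ : ∀ {u v} → Edge X′ u v → Adj G u v
        sound′ e with nextX⁻ e
        ... | inj₁ x        = sound x
        ... | inj₂ (inj₁ c) = consecutive-adjacent c
        ... | inj₂ (inj₂ c) = Graph.sym G _ _ (consecutive-adjacent c)
        symmetric′ : ∀ {u v} → Edge X′ u v → Edge X′ v u
        symmetric′ e with nextX⁻ e
        ... | inj₁ x        = nextX⁺ (inj₁ (symmetric x))
        ... | inj₂ (inj₁ c) = nextX⁺ (inj₂ (inj₂ c))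
        ... | inj₂ (inj₂ c) = nextX⁺ (inj₂ (inj₁ c))
        complete′ : ∀ {u v} → Adj G u v → Edge X′ u v ⊎ Edge Z′ u v
        complete′ {u} {v} e with T? (X′ u v) | complete e
        ... | yes x | _      = inj₁ x
        ... | no ¬x | inj₁ x = contradiction (nextX⁺ (inj₁ x)) ¬x
        ... | no ¬x | inj₂ z = inj₂ (does⁺ (remains? X Z pq π u v) (z , ¬x , λ r → refuted pq r e))

      NewEdge : Set
      NewEdge = count X < count X′ × count Z′ < count Z

      new-edge : ∀ {u v} → Consecutive π u v → ¬ Edge X u v → NewEdge
      new-edge {u} {v} c ¬x =
        count-strict X X′ (λ x → nextX⁺ (inj₁ x)) (nextX⁺ (inj₂ (inj₁ c))) ¬x ,
        count-strict Z′ Z (λ z → proj₁ (nextZ⁻ z)) undecided (λ z → proj₁ (proj₂ (nextZ⁻ z)) (nextX⁺ (inj₂ (inj₁ c))))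
        where
        undecided : Edge Z u v
        undecided with complete (consecutive-adjacent c)
        ... | inj₁ x = contradiction x ¬x
        ... | inj₂ z = z

      refutes-gain : dist X n (proj₁ pq) (proj₂ pq) < length π → count Z′ + gain X Z pq ≤ count Z
      refutes-gain short = ≤-trans (≤-reflexive (sym (∑-+ (pairs n) _ _)))
        (∑-mono (pairs n) (λ (u , v) → 𝟙-disjoint (T? (Z′ u v)) (T? (Z u v) ×-dec resolves? X pq u v) (T? (Z u v))
          (λ z → proj₁ (nextZ⁻ z)) proj₁ (λ z (_ , r) → proj₂ (proj₂ (nextZ⁻ z)) (short , r))))

      -- The cases depend on whether the answer uses an unknown edge, not on its length: any unknown
      -- edge is progress, and an answer made of known edges is no shorter than the known distance.
      short-or-new : NewEdge ⊎ dist X n (proj₁ pq) (proj₂ pq) < length π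
      short-or-new with linked-or-not (λ a b → T? (X a b)) π
      ... | inj₁ es               = inj₂ (known-linked⇒dist< X _ _ es)
      ... | inj₂ (a , b , c , ¬x) = inj₁ (new-edge c ¬x)

    Progress : Fin n × Fin n → Set
    Progress pq = NewEdge pq ⊎
      (Reachable X Z × (∀ pq′ → gain X Z pq′ ≤ gain X Z pq) × count (Z′ pq) + gain X Z pq ≤ count Z)

    progress : ∀ uv → Progress (proj₁ (choose X Z uv))
    progress uv with choose X Z uv
    ... | pq , choice with short-or-new pq | choice
    ...   | inj₁ new   | _                    = inj₁ new
    -- An answer has at most `n` vertices, so `n ≤ dist` leaves only the case of a new edge.
    ...   | inj₂ short | inj₁ far             = contradiction (≤-trans (answer≤n _ _) far) (<⇒≱ short)
    ...   | inj₂ short | inj₂ (reach , best)  = inj₂ (reach , best , refutes-gain pq short)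

    known : ∀ {Δ} → (∀ u → length (neighbours (edges G) u) ≤ Δ) → Reachable X Z → Known n Δ
    known deg reach = record
      { edgeSet   = X
      ; symmetric = symmetric
      ; reachable = reach
      ; degree≤   = λ u → ≤-trans (neighbours-mono u) (deg u)
      }
      where
      neighbours-mono : ∀ u → length (neighbours X u) ≤ length (neighbours (edges G) u)
      neighbours-mono u = subst₂ _≤_ (sym (length-filter≡∑ (λ v → T? (X u v)) (allFin n)))
        (sym (length-filter≡∑ (λ v → T? (edges G u v)) (allFin n)))
        (∑-mono (allFin n) (λ v → 𝟙-mono (T? (X u v)) (T? (edges G u v)) sound))

    gain-pos : ∀ {u v} → Edge Z u v → Reachable X Z → 0 < gain X Z (u , v)
    gain-pos {u} {v} z reach = <-≤-trans (subst (0 <_) (sym (𝟙-yes (T? (Z u v) ×-dec resolves? X (u , v) u v)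
        (z , Metric.self-resolves (known (neighbours≤n (edges G)) reach) (proj₁ (fresh z)) (proj₂ (fresh z))))) z<s)
      (∑-∈ (λ (a , b) → 𝟙 (T? (Z a b) ×-dec resolves? X (u , v) a b)) (∈-pairs (u , v)))

    count-decreases : ∀ {u v} → Edge Z u v → ∀ pq → Progress pq → count (Z′ pq) < count Z
    count-decreases         z pq (inj₁ (_ , lt))              = lt
    count-decreases {u} {v} z pq (inj₂ (reach , best , decr)) = begin-strict
      count (Z′ pq)                ≡⟨ +-identityʳ _ ⟨
      count (Z′ pq) + 0            <⟨ +-monoʳ-< (count (Z′ pq)) (<-≤-trans (gain-pos z reach) (best (u , v))) ⟩
      count (Z′ pq) + gain X Z pq  ≤⟨ decr ⟩
      count Z                      ∎
      where open ≤-Reasoning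

    decided : ¬ (∃[ u ] ∃[ v ] Edge Z u v) → ∀ u v → X u v ≡ edges G u v
    decided none u v = T-ext sound complete′
      where
      complete′ : Adj G u v → Edge X u v
      complete′ e with complete e
      ... | inj₁ x = x
      ... | inj₂ z = contradiction (u , v , z) none

    -- Double counting: every undecided pair is a nonedge of `X` by `fresh`, so it contributes to
    -- the gain of some member of `qs`.
    certificate-covers : ∀ {qs g} → Certificate X qs → (∀ pq → gain X Z pq ≤ g) → count Z ≤ length qs * g
    certificate-covers {qs} {g} cert best = begin
      count Z                                                                 ≤⟨ ∑-mono (pairs n) covered ⟩
      ∑ (pairs n) (λ (u , v) → ∑ qs (λ pq → 𝟙 (T? (Z u v) ×-dec resolves? X pq u v)))  ≡⟨ ∑-swap (pairs n) qs _ ⟩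
      ∑ qs (gain X Z)                                                         ≤⟨ ∑-bound qs best ⟩
      length qs * g                                                           ∎
      where
      open ≤-Reasoning
      covered : ∀ uv → 𝟙 (T? (Z (proj₁ uv) (proj₂ uv))) ≤ ∑ qs (λ pq → 𝟙 (T? (Z (proj₁ uv) (proj₂ uv)) ×-dec resolves? X pq (proj₁ uv) (proj₂ uv)))
      covered (u , v) = go (T? (Z u v))
        where
        go : (z? : Dec (Edge Z u v)) → 𝟙 z? ≤ ∑ qs (λ pq → 𝟙 (T? (Z u v) ×-dec resolves? X pq u v))
        go (no _)  = z≤n
        go (yes z) with pq , i , r ← cert u v (proj₁ (fresh z)) (proj₂ (fresh z)) =
          ≤-trans (≤-reflexive (sym (𝟙-yes (T? (Z u v) ×-dec resolves? X pq u v) (z , r))))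
            (∑-∈ (λ pq → 𝟙 (T? (Z u v) ×-dec resolves? X pq u v)) i)

-- Counting the queries

module Performance {n : ℕ} {G : Graph n} (O : Oracle G) where
  open Analysis O

  solve-correct : ∀ k X Z → Invariant X Z → count Z ≤ k → ∀ u v → output O (solve k X Z) u v ≡ edges G u v
  solve-correct zero X Z I le u v = decided I (λ (u , v , z) → <⇒≱ (count-pos Z z) le) u v
  solve-correct (suc k) X Z I le u v with undecided? X Z
  ... | no none           = decided I none u v
  ... | yes (a , b , z) = solve-correct k (X′ I pq) (Z′ I pq) (invariant-next I pq)
      (s≤s⁻¹ (<-≤-trans (count-decreases I z pq (progress I (a , b))) le)) u v
    where
    pq = proj₁ (choose X Z (a , b))

  queries≤fuel : ∀ k X Z → queries O (solve k X Z) ≤ k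
  queries≤fuel zero    X Z = z≤n
  queries≤fuel (suc k) X Z with undecided? X Z
  ... | no _          = z≤n
  ... | yes (a , b , _) = s≤s (queries≤fuel k _ _)

  module _ (f : ℕ)
    (certificates : ∀ X Z → Invariant X Z → Reachable X Z → ∃[ qs ] (length qs ≤ f × Certificate X qs)) where

    -- An amortised account with two budgets: a query either raises `count X`, which is capped by
    -- `count (edges G)`, or uses up one of the `N` steps of geometric decrease.
    Spent : (X : EdgeSet n) (q N : ℕ) → Set
    Spent X q N = count X + q ≤ count (edges G) + N

    spend : ∀ {X Z} (I : Invariant X Z) pq {N u v} → Edge Z u v → Progress I pq → Steps f (count Z) N →
      ∃[ N′ ] (Steps f (count (Z′ I pq)) N′ × (∀ {q} → Spent (X′ I pq) q N′ → Spent X (suc q) N))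
    spend {X} {Z} I pq {N} z (inj₁ (known< , left<)) st = N , steps-mono (<⇒≤ left<) st , λ {q} le → begin
      count X + suc q               ≡⟨ +-suc (count X) q ⟩
      suc (count X + q)             ≤⟨ +-monoˡ-≤ q known< ⟩
      count (X′ I pq) + q           ≤⟨ le ⟩
      count (edges G) + N           ∎
      where open ≤-Reasoning
    spend {X} {Z} I pq {N} {u} {v} z (inj₂ (reach , best , decr)) st =
      let qs , len , cert = certificates X Z I reach
          covers = ≤-trans (certificate-covers I {qs} {gain X Z pq} cert best) (*-monoˡ-≤ (gain X Z pq) len)
          N′ , eq , st′ = steps-step {f} {count Z} {count (Z′ I pq)} {gain X Z pq} {N} (count-pos Z z) covers decr st
      in N′ , st′ , λ {q} le → begin
      count X + suc q               ≡⟨ +-suc (count X) q ⟩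
      suc (count X + q)             ≤⟨ s≤s (+-monoˡ-≤ q (count-mono X (X′ I pq) (λ x → nextX⁺ I pq (inj₁ x)))) ⟩
      suc (count (X′ I pq) + q)     ≤⟨ s≤s le ⟩
      suc (count (edges G) + N′)    ≡⟨ +-suc (count (edges G)) N′ ⟨
      count (edges G) + suc N′      ≡⟨ cong (count (edges G) +_) eq ⟨
      count (edges G) + N           ∎
      where open ≤-Reasoning

    queries-bound : ∀ k X Z N → Invariant X Z → Steps f (count Z) N → Spent X (queries O (solve k X Z)) N
    queries-bound zero X Z N I st =
      ≤-trans (≤-reflexive (+-identityʳ _)) (≤-trans (count-mono X (edges G) (Invariant.sound I)) (m≤m+n _ N))
    queries-bound (suc k) X Z N I st with undecided? X Z
    ... | no _ =
      ≤-trans (≤-reflexive (+-identityʳ _)) (≤-trans (count-mono X (edges G) (Invariant.sound I)) (m≤m+n _ N))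
    ... | yes (a , b , z) =
      let pq = proj₁ (choose X Z (a , b))
          N′ , st′ , conclude = spend I pq z (progress I (a , b)) st
      in conclude (queries-bound k (X′ I pq) (Z′ I pq) N′ (invariant-next I pq) st′)

    reconstruct-queries : ∀ {J} .{{_ : NonZero f}} → n * n < 2 ^ J →
      queries O (reconstruct n) ≤ count (edges G) + f * J
    reconstruct-queries {J} lt = ≤-trans (m≤n+m _ (count {n} noEdges))
      (queries-bound (n * n) noEdges distinct (f * J) initial (steps-start {f} {count {n} distinct} {J}
        (≤-<-trans (count≤ {n} distinct (neighbours≤n distinct)) lt)))

  reconstruct-correct : ∀ u v → output O (reconstruct n) u v ≡ edges G u v
  reconstruct-correct = solve-correct (n * n) noEdges distinct initial (count≤ {n} distinct (neighbours≤n distinct))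

  reconstruct-queries≤n² : queries O (reconstruct n) ≤ n * n
  reconstruct-queries≤n² = queries≤fuel (n * n) noEdges distinct

-- Arithmetic of the bounds

^-distribʳ-* : ∀ m o k → (m * o) ^ k ≡ m ^ k * o ^ k
^-distribʳ-* m o zero    = refl
^-distribʳ-* m o (suc k) = trans (cong (m * o *_) (^-distribʳ-* m o k)) (identity m o (m ^ k) (o ^ k))
  where
  identity : ∀ m o x y → m * o * (x * y) ≡ m * x * (o * y)
  identity = solve-∀

^-cancelˡ-≤ : ∀ {m o} k .{{_ : NonZero k}} → m ^ k ≤ o ^ k → m ≤ o
^-cancelˡ-≤ k le = ≮⇒≥ λ lt → <⇒≱ (^-monoˡ-< k lt) le

2^-cancel-≤ : ∀ {m o} → 2 ^ m ≤ 2 ^ o → m ≤ o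
2^-cancel-≤ le = ≮⇒≥ λ lt → <⇒≱ (^-monoʳ-< 2 ≤-refl lt) le

1≤^ : ∀ {m} k → 1 ≤ m → 1 ≤ m ^ k
1≤^ {m} k le = m^n>0 m {{>-nonZero le}} k

log₂-bounds : ∀ n → 1 ≤ n → ∃[ ℓ ] (2 ^ ℓ ≤ n × n < 2 ^ suc ℓ)
log₂-bounds 1 _ = 0 , ≤-refl , ≤-refl
log₂-bounds (suc n@(suc _)) _ with ℓ , lo , hi ← log₂-bounds n z<s with suc n <? 2 ^ suc ℓ
... | yes lt = ℓ , m≤n⇒m≤1+n lo , lt
... | no ¬lt = suc ℓ , ≮⇒≥ ¬lt , ≤-<-trans hi (^-monoʳ-< 2 ≤-refl {suc ℓ} {suc (suc ℓ)} ≤-refl)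

root-between : ∀ k .{{_ : NonZero k}} n → ∃[ s ] (s ^ k ≤ n × n ≤ suc s ^ k)
root-between (suc _) zero    = 0 , z≤n , z≤n
root-between k       (suc n) with s , lo , hi ← root-between k n with suc n ≤? suc s ^ k
... | yes le = s , m≤n⇒m≤1+n lo , le
... | no ¬le = suc s , <⇒≤ (≰⇒> ¬le) , ≤-<-trans hi (^-monoˡ-< k ≤-refl)

-- Rounding a root up at most doubles it, which costs `2 ^ k` in the power.
root-above : ∀ k .{{_ : NonZero k}} n → 1 ≤ n → ∃[ s ] (n ≤ suc s ^ k × suc s ^ k ≤ 2 ^ k * n)
root-above k n 1≤n with root-between k n
... | zero  , lo , hi = 0 , hi , (begin
  1 ^ k      ≡⟨ ^-zeroˡ k ⟩
  1          ≤⟨ *-mono-≤ (1≤^ {2} k (s≤s z≤n)) 1≤n ⟩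
  2 ^ k * n  ∎)
  where open ≤-Reasoning
... | suc s , lo , hi = suc s , hi , (begin
  suc (suc s) ^ k    ≤⟨ ^-monoˡ-≤ k (≤-trans (s≤s (m≤n+m (suc s) s)) (≤-reflexive (cong (suc s +_) (sym (+-identityʳ (suc s)))))) ⟩
  (2 * suc s) ^ k    ≡⟨ ^-distribʳ-* 2 (suc s) k ⟩
  2 ^ k * suc s ^ k  ≤⟨ *-monoʳ-≤ (2 ^ k) lo ⟩
  2 ^ k * n          ∎)
  where open ≤-Reasoning

-- `suc k` will be the depth of the recursion, an integer between `b / a` and twice that.
ratio-above : ∀ a b .{{_ : NonZero a}} → a ≤ b → ∃[ k ] (b ≤ suc k * a × suc k * a ≤ 2 * b)
ratio-above a b a≤b = b / a , (begin
  b                    ≡⟨ m≡m%n+[m/n]*n b a ⟩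
  b % a + b / a * a    ≤⟨ +-monoˡ-≤ (b / a * a) (<⇒≤ (m%n<n b a)) ⟩
  suc (b / a) * a      ∎) , (begin
  a + b / a * a        ≤⟨ +-mono-≤ a≤b (m/n*n≤m b a) ⟩
  b + b                ≡⟨ cong (b +_) (+-identityʳ b) ⟨
  2 * b                ∎)
  where open ≤-Reasoning

-- Since `ℓ` and 1 are both at most `log₂ n`, their sum is at most twice any `c / d` above it.
log₂-scaled : ∀ {n c d ℓ} → 2 ≤ n → Log₂≤ n c d → 2 ^ ℓ ≤ n → suc ℓ * d ≤ 2 * c × d ≤ c
log₂-scaled {n} {c} {d} {ℓ} 2≤n logn lo = (begin
  d + ℓ * d  ≤⟨ +-mono-≤ d≤c (2^-cancel-≤ (begin
    2 ^ (ℓ * d)   ≡⟨ ^-*-assoc 2 ℓ d ⟨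
    (2 ^ ℓ) ^ d   ≤⟨ ^-monoˡ-≤ d lo ⟩
    n ^ d         ≤⟨ logn ⟩
    2 ^ c         ∎)) ⟩
  c + c      ≡⟨ cong (c +_) (+-identityʳ c) ⟨
  2 * c      ∎) , d≤c
  where
  open ≤-Reasoning
  d≤c : d ≤ c
  d≤c = 2^-cancel-≤ (≤-trans (^-monoˡ-≤ d 2≤n) logn)

square<2^ : ∀ n ℓ → n < 2 ^ ℓ → n * n < 2 ^ (2 * ℓ)
square<2^ n ℓ lt = <-≤-trans (*-mono-< lt lt)
  (≤-reflexive (trans (sym (^-distribˡ-+-* 2 ℓ ℓ)) (cong (λ x → 2 ^ (ℓ + x)) (sym (+-identityʳ ℓ)))))

-- The 17 is 1 for the edges plus 16: the 2 in `2 * L`, two more from the two uses of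
-- `L * d ≤ 2 * c`, and one from `suc Δ ≤ 2 * Δ`.
treewidth-arithmetic : ∀ {n Δ w q c d L} → 1 ≤ Δ → L * d ≤ 2 * c → d ≤ c →
  q ≤ n * Δ + n * (L * (suc w * suc Δ)) * (2 * L) →
  q * d ^ 3 ≤ 17 * (Δ * (Δ * d + w * c) * n * c ^ 2)
treewidth-arithmetic {n} {Δ} {w} {q} {c} {d} {L} 1≤Δ Ld≤2c d≤c q≤ = begin
  q * d ^ 3
    ≤⟨ *-monoˡ-≤ (d ^ 3) q≤ ⟩
  (n * Δ + n * (L * (suc w * suc Δ)) * (2 * L)) * d ^ 3
    ≡⟨ split n Δ L w d ⟩
  n * Δ * d * (d * d) + 2 * (n * (L * d * (L * d)) * (d + w * d) * suc Δ)
    ≤⟨ +-mono-≤ (*-mono-≤ (*-monoʳ-≤ (n * Δ) d≤S) (*-mono-≤ d≤c d≤c))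
         (*-monoʳ-≤ 2 (*-mono-≤ (*-mono-≤ (*-monoʳ-≤ n (*-mono-≤ Ld≤2c Ld≤2c)) (+-mono-≤ d≤Δd (*-monoʳ-≤ w d≤c))) 1+Δ≤2Δ)) ⟩
  n * Δ * S * (c * c) + 2 * (n * (2 * c * (2 * c)) * S * (2 * Δ))
    ≡⟨ collect n Δ S c ⟩
  17 * (Δ * S * n * c ^ 2) ∎
  where
  open ≤-Reasoning
  S = Δ * d + w * c
  d≤Δd : d ≤ Δ * d
  d≤Δd = ≤-trans (≤-reflexive (sym (*-identityˡ d))) (*-monoˡ-≤ d 1≤Δ)
  d≤S : d ≤ S
  d≤S = ≤-trans d≤Δd (m≤m+n _ _)
  1+Δ≤2Δ : suc Δ ≤ 2 * Δ
  1+Δ≤2Δ = +-mono-≤ 1≤Δ (≤-reflexive (sym (+-identityʳ Δ)))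
  split : ∀ n Δ L w d → (n * Δ + n * (L * (suc w * suc Δ)) * (2 * L)) * (d * (d * (d * 1)))
    ≡ n * Δ * d * (d * d) + 2 * (n * (L * d * (L * d)) * (d + w * d) * suc Δ)
  split = solve-∀
  collect : ∀ n Δ S c → n * Δ * S * (c * c) + 2 * (n * (2 * c * (2 * c)) * S * (2 * Δ))
    ≡ 17 * (Δ * S * n * (c * (c * 1)))
  collect = solve-∀

-- Both summands of the recursion are bounded by the same term; the 2 in `2 * B` pays for adding
-- them.
certificateSize≤ : ∀ {B s R} k → 2 * B ≤ s * R → 1 ≤ R → certificateSize B s k ≤ s ^ suc k * R ^ k
certificateSize≤ zero _ _ = z≤n
certificateSize≤ {B} {s} {R} (suc k) 2B≤sR 1≤R = begin
  B * (s ^ suc k + certificateSize B s k)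
    ≤⟨ *-monoʳ-≤ B (+-mono-≤ (≤-trans (≤-reflexive (sym (*-identityʳ (s ^ suc k)))) (*-monoʳ-≤ (s ^ suc k) (1≤^ k 1≤R)))
         (certificateSize≤ {B} {s} {R} k 2B≤sR 1≤R)) ⟩
  B * (s ^ suc k * R ^ k + s ^ suc k * R ^ k)
    ≡⟨ double B (s ^ suc k * R ^ k) ⟩
  2 * B * (s ^ suc k * R ^ k)
    ≤⟨ *-monoˡ-≤ (s ^ suc k * R ^ k) 2B≤sR ⟩
  s * R * (s ^ suc k * R ^ k)
    ≡⟨ regroup s R (s ^ suc k) (R ^ k) ⟩
  s ^ suc (suc k) * R ^ suc k ∎
  where
  open ≤-Reasoning
  double : ∀ B x → B * (x + x) ≡ 2 * B * x
  double = solve-∀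
  regroup : ∀ s R x y → s * R * (x * y) ≡ s * x * (R * y)
  regroup = solve-∀

-- The 20 is 5 · 4: five copies of `s * L` from the number of centres, and `2 * Δ` for `suc Δ`
-- twice.
branching-bound : ∀ {s Δ L} → 1 ≤ s → 1 ≤ Δ → 1 ≤ L →
  suc (2 * s * (2 * L)) * suc Δ * suc Δ ≤ s * (20 * (Δ * L * (Δ * L)))
branching-bound {s} {Δ} {L} 1≤s 1≤Δ 1≤L = begin
  suc (2 * s * (2 * L)) * suc Δ * suc Δ
    ≤⟨ *-mono-≤ (*-mono-≤ (+-monoˡ-≤ (2 * s * (2 * L)) (*-mono-≤ 1≤s 1≤L)) (+-monoˡ-≤ Δ 1≤Δ)) (+-monoˡ-≤ Δ 1≤Δ) ⟩
  (s * L + 2 * s * (2 * L)) * (Δ + Δ) * (Δ + Δ)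
    ≡⟨ collect s Δ L ⟩
  s * (20 * (Δ * (Δ * L) * 1))
    ≤⟨ *-monoʳ-≤ s (*-monoʳ-≤ 20 (*-monoʳ-≤ (Δ * (Δ * L)) 1≤L)) ⟩
  s * (20 * (Δ * (Δ * L) * L))
    ≡⟨ regroup s Δ L ⟩
  s * (20 * (Δ * L * (Δ * L))) ∎
  where
  open ≤-Reasoning
  collect : ∀ s Δ L → (s * L + 2 * s * (2 * L)) * (Δ + Δ) * (Δ + Δ) ≡ s * (20 * (Δ * (Δ * L) * 1))
  collect = solve-∀
  regroup : ∀ s Δ L → s * (20 * (Δ * (Δ * L) * L)) ≡ s * (20 * (Δ * L * (Δ * L)))
  regroup = solve-∀

-- Numerical constants are absorbed into powers of `N`, here by `40 ≤ 2 ^ 6`.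
40N²≤N⁸ : ∀ {N} → 2 ≤ N → 40 * (N * N) ≤ N ^ 8
40N²≤N⁸ {N} 2≤N = begin
  40 * (N * N)     ≤⟨ *-monoˡ-≤ (N * N) (≤-trans (m≤m+n 40 24) (^-monoˡ-≤ 6 2≤N)) ⟩
  N ^ 6 * (N * N)  ≡⟨ regroup N ⟩
  N ^ 8            ∎
  where
  open ≤-Reasoning
  regroup : ∀ N → N * (N * (N * (N * (N * (N * 1))))) * (N * N) ≡ N * (N * (N * (N * (N * (N * (N * (N * 1)))))))
  regroup = solve-∀

-- With M = (Δ L)^k, the exponent 12 consists of 8 from the branching, 1 that absorbs `2 ^ k` from
-- the rounded root, and 3 that absorb `3 * N`.
general-query-bound : ∀ {n Δ L s q} k .{{_ : NonZero k}} → 1 ≤ s → 1 ≤ Δ → 2 ≤ L → s ^ k ≤ 2 ^ k * n →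
  q ≤ n * Δ + s ^ suc k * ((Δ * L) ^ 8) ^ k * (2 * L) → q ≤ n * s * ((Δ * L) ^ k) ^ 12
general-query-bound {n} {Δ} {L} {s} {q} k 1≤s 1≤Δ 2≤L root q≤ = begin
  q
    ≤⟨ q≤ ⟩
  n * Δ + s * s ^ k * (N ^ 8) ^ k * (2 * L)
    ≤⟨ +-mono-≤ (*-monoʳ-≤ n Δ≤N) (*-mono-≤ (*-mono-≤ (*-monoʳ-≤ s root′) (≤-reflexive swap-powers)) (*-monoʳ-≤ 2 L≤N)) ⟩
  n * N + s * (M * n) * M ^ 8 * (2 * N)
    ≡⟨ cong (_+ s * (M * n) * M ^ 8 * (2 * N)) (unit n N) ⟩
  n * 1 * N * 1 + s * (M * n) * M ^ 8 * (2 * N)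
    ≤⟨ +-monoˡ-≤ _ (*-mono-≤ (*-monoˡ-≤ N (*-monoʳ-≤ n 1≤s)) (1≤^ 9 1≤M)) ⟩
  n * s * N * M ^ 9 + s * (M * n) * M ^ 8 * (2 * N)
    ≡⟨ collect n s N M ⟩
  n * s * (3 * N) * M ^ 9
    ≤⟨ *-monoˡ-≤ (M ^ 9) (*-monoʳ-≤ (n * s) 3N≤M³) ⟩
  n * s * M ^ 3 * M ^ 9
    ≡⟨ regroup n s M ⟩
  n * s * M ^ 12 ∎
  where
  open ≤-Reasoning
  N = Δ * L
  M = N ^ k
  Δ≤N : Δ ≤ N
  Δ≤N = ≤-trans (≤-reflexive (sym (*-identityʳ Δ))) (*-monoʳ-≤ Δ (≤-trans (s≤s z≤n) 2≤L))
  L≤N : L ≤ N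
  L≤N = ≤-trans (≤-reflexive (sym (*-identityˡ L))) (*-monoˡ-≤ L 1≤Δ)
  2≤N : 2 ≤ N
  2≤N = ≤-trans 2≤L L≤N
  1≤M : 1 ≤ M
  1≤M = 1≤^ k (≤-trans (s≤s z≤n) 2≤N)
  N≤M : N ≤ M
  N≤M = ≤-trans (≤-reflexive (sym (*-identityʳ N)))
    (^-monoʳ-≤ N {{>-nonZero (≤-trans (s≤s z≤n) 2≤N)}} (>-nonZero⁻¹ k))
  root′ : s ^ k ≤ M * n
  root′ = ≤-trans root (*-monoˡ-≤ n (^-monoˡ-≤ k 2≤N))
  swap-powers : (N ^ 8) ^ k ≡ M ^ 8
  swap-powers = trans (^-*-assoc N 8 k) (trans (cong (N ^_) (*-comm 8 k)) (sym (^-*-assoc N k 8)))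
  3N≤M³ : 3 * N ≤ M ^ 3
  3N≤M³ = begin
    3 * N              ≤⟨ *-mono-≤ {3} {2 * 2} (m≤m+n 3 1) N≤M ⟩
    2 * 2 * M          ≤⟨ *-monoˡ-≤ M (*-mono-≤ (≤-trans 2≤N N≤M) (≤-trans 2≤N N≤M)) ⟩
    M * M * M          ≡⟨ cube M ⟩
    M ^ 3              ∎
    where
    cube : ∀ M → M * M * M ≡ M * (M * (M * 1))
    cube = solve-∀
  unit : ∀ n N → n * N ≡ n * 1 * N * 1
  unit = solve-∀
  collect : ∀ n s N M → n * s * N * (M * (M * (M * (M * (M * (M * (M * (M * (M * 1)))))))))
      + s * (M * n) * (M * (M * (M * (M * (M * (M * (M * (M * 1)))))))) * (2 * N)
    ≡ n * s * (3 * N) * (M * (M * (M * (M * (M * (M * (M * (M * (M * 1)))))))))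
  collect = solve-∀
  regroup : ∀ n s M → n * s * (M * (M * (M * 1))) * (M * (M * (M * (M * (M * (M * (M * (M * (M * 1)))))))))
    ≡ n * s * (M * (M * (M * (M * (M * (M * (M * (M * (M * (M * (M * (M * 1))))))))))))
  regroup = solve-∀

-- Bounds in terms of the root in the exponent

module RootBound {n Δ a b c d L : ℕ} {{_ : NonZero b}} {{_ : NonZero d}} (4≤n : 4 ≤ n) (1≤Δ : 1 ≤ Δ)
  (logn : Log₂≤ n c d) (Ld≤2c : L * d ≤ 2 * c) (root : (Δ * c) ^ (b * b) ≤ n ^ (a * a) * d ^ (b * b)) where
  open ≤-Reasoning

  instance
    n≢0 : NonZero n
    n≢0 = >-nonZero (≤-trans (s≤s z≤n) 4≤n)

    d^b²≢0 : NonZero (d ^ (b * b))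
    d^b²≢0 = m^n≢0 d (b * b)

    b²≢0 : NonZero (b * b)
    b²≢0 = m*n≢0 b b

  2d≤c : 2 * d ≤ c
  2d≤c = 2^-cancel-≤ (begin
    2 ^ (2 * d)  ≡⟨ ^-*-assoc 2 2 d ⟨
    4 ^ d        ≤⟨ ^-monoˡ-≤ d 4≤n ⟩
    n ^ d        ≤⟨ logn ⟩
    2 ^ c        ∎)

  -- For `4 ≤ n` the logarithm is at least 2, so the root cannot be too small to pay for factors of
  -- 2. This is the origin of the threshold 4.
  2^b²≤n^a² : 2 ^ (b * b) ≤ n ^ (a * a)
  2^b²≤n^a² = *-cancelʳ-≤ (2 ^ (b * b)) (n ^ (a * a)) (d ^ (b * b)) (begin
    2 ^ (b * b) * d ^ (b * b)  ≡⟨ ^-distribʳ-* 2 d (b * b) ⟨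
    (2 * d) ^ (b * b)          ≤⟨ ^-monoˡ-≤ (b * b) (≤-trans 2d≤c (≤-trans (≤-reflexive (sym (*-identityˡ c))) (*-monoˡ-≤ c 1≤Δ))) ⟩
    (Δ * c) ^ (b * b)          ≤⟨ root ⟩
    n ^ (a * a) * d ^ (b * b)  ∎)

  N^b²≤n^2a² : (Δ * L) ^ (b * b) ≤ n ^ (a * a) * n ^ (a * a)
  N^b²≤n^2a² = *-cancelʳ-≤ ((Δ * L) ^ (b * b)) (n ^ (a * a) * n ^ (a * a)) (d ^ (b * b)) (begin
    (Δ * L) ^ (b * b) * d ^ (b * b)              ≡⟨ ^-distribʳ-* (Δ * L) d (b * b) ⟨
    (Δ * L * d) ^ (b * b)                        ≡⟨ cong (_^ (b * b)) (*-assoc Δ L d) ⟩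
    (Δ * (L * d)) ^ (b * b)                      ≤⟨ ^-monoˡ-≤ (b * b) (*-monoʳ-≤ Δ Ld≤2c) ⟩
    (Δ * (2 * c)) ^ (b * b)                      ≡⟨ cong (_^ (b * b)) (regroup Δ c) ⟩
    (2 * (Δ * c)) ^ (b * b)                      ≡⟨ ^-distribʳ-* 2 (Δ * c) (b * b) ⟩
    2 ^ (b * b) * (Δ * c) ^ (b * b)              ≤⟨ *-mono-≤ 2^b²≤n^a² root ⟩
    n ^ (a * a) * (n ^ (a * a) * d ^ (b * b))    ≡⟨ *-assoc (n ^ (a * a)) _ _ ⟨
    n ^ (a * a) * n ^ (a * a) * d ^ (b * b)      ∎)
    where
    regroup : ∀ Δ c → Δ * (2 * c) ≡ 2 * (Δ * c)
    regroup = solve-∀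

  a≢0 : NonZero a
  a≢0 = ≢-nonZero λ { refl → <⇒≱ (^-monoʳ-< 2 ≤-refl {0} {b * b} (>-nonZero⁻¹ (b * b))) 2^b²≤n^a² }

  2^b≤n^a : a ≤ b → 2 ^ b ≤ n ^ a
  2^b≤n^a a≤b = ^-cancelˡ-≤ b (begin
    (2 ^ b) ^ b  ≡⟨ ^-*-assoc 2 b b ⟩
    2 ^ (b * b)  ≤⟨ 2^b²≤n^a² ⟩
    n ^ (a * a)  ≤⟨ ^-monoʳ-≤ n (*-monoʳ-≤ a a≤b) ⟩
    n ^ (a * b)  ≡⟨ ^-*-assoc n a b ⟨
    (n ^ a) ^ b  ∎)

  -- In real exponents: `Δ * L` is at most n^(2a²/b²), and its `k`-th power with k ≤ 2b/a is at most
  -- n^(4a/b).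
  N^kb≤n^4a : ∀ k → k * a ≤ 2 * b → ((Δ * L) ^ k) ^ b ≤ n ^ (4 * a)
  N^kb≤n^4a k ka≤2b = ^-cancelˡ-≤ b (begin
    (((Δ * L) ^ k) ^ b) ^ b          ≡⟨ ^-*-assoc ((Δ * L) ^ k) b b ⟩
    ((Δ * L) ^ k) ^ (b * b)          ≡⟨ ^-*-assoc (Δ * L) k (b * b) ⟩
    (Δ * L) ^ (k * (b * b))          ≡⟨ cong ((Δ * L) ^_) (*-comm k (b * b)) ⟩
    (Δ * L) ^ (b * b * k)            ≡⟨ ^-*-assoc (Δ * L) (b * b) k ⟨
    ((Δ * L) ^ (b * b)) ^ k          ≤⟨ ^-monoˡ-≤ k N^b²≤n^2a² ⟩
    (n ^ (a * a) * n ^ (a * a)) ^ k  ≡⟨ cong (_^ k) (^-distribˡ-+-* n (a * a) (a * a)) ⟨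
    (n ^ (a * a + a * a)) ^ k        ≡⟨ ^-*-assoc n (a * a + a * a) k ⟩
    n ^ ((a * a + a * a) * k)        ≤⟨ ^-monoʳ-≤ n exponent ⟩
    n ^ (4 * a * b)                  ≡⟨ ^-*-assoc n (4 * a) b ⟨
    (n ^ (4 * a)) ^ b                ∎)
    where
    exponent : (a * a + a * a) * k ≤ 4 * a * b
    exponent = begin
      (a * a + a * a) * k  ≡⟨ left a k ⟩
      2 * a * (k * a)      ≤⟨ *-monoʳ-≤ (2 * a) ka≤2b ⟩
      2 * a * (2 * b)      ≡⟨ right a b ⟩
      4 * a * b            ∎
      where
      left : ∀ a k → (a * a + a * a) * k ≡ 2 * a * (k * a)
      left = solve-∀
      right : ∀ a b → 2 * a * (2 * b) ≡ 4 * a * b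
      right = solve-∀

  -- Here `s` is at most 2 n^(1/k). As k ≥ b/a, the factor n^(1/k) costs exponent `a` after raising
  -- to the power `b`; the powers of 2 cost `2 * a`.
  s^b≤n^3a : ∀ {s} k → 1 ≤ s → a ≤ b → b ≤ k * a → k * a ≤ 2 * b → s ^ k ≤ 2 ^ k * n → s ^ b ≤ n ^ (3 * a)
  s^b≤n^3a {s} k 1≤s a≤b b≤ka ka≤2b rt = begin
    s ^ b                      ≤⟨ ^-monoʳ-≤ s {{>-nonZero 1≤s}} b≤ka ⟩
    s ^ (k * a)                ≡⟨ ^-*-assoc s k a ⟨
    (s ^ k) ^ a                ≤⟨ ^-monoˡ-≤ a rt ⟩
    (2 ^ k * n) ^ a            ≡⟨ ^-distribʳ-* (2 ^ k) n a ⟩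
    (2 ^ k) ^ a * n ^ a        ≡⟨ cong (_* n ^ a) (^-*-assoc 2 k a) ⟩
    2 ^ (k * a) * n ^ a        ≤⟨ *-monoˡ-≤ (n ^ a) (^-monoʳ-≤ 2 ka≤2b) ⟩
    2 ^ (2 * b) * n ^ a        ≡⟨ cong (λ x → 2 ^ x * n ^ a) (*-comm 2 b) ⟩
    2 ^ (b * 2) * n ^ a        ≡⟨ cong (_* n ^ a) (^-*-assoc 2 b 2) ⟨
    (2 ^ b) ^ 2 * n ^ a        ≤⟨ *-monoˡ-≤ (n ^ a) (^-monoˡ-≤ 2 (2^b≤n^a a≤b)) ⟩
    (n ^ a) ^ 2 * n ^ a        ≡⟨ *-comm ((n ^ a) ^ 2) (n ^ a) ⟩
    (n ^ a) ^ 3                ≡⟨ ^-*-assoc n a 3 ⟩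
    n ^ (a * 3)                ≡⟨ cong (n ^_) (*-comm a 3) ⟩
    n ^ (3 * a)                ∎

  -- The constant is 51 = 3 + 4 · 12: the exponent of `s`, and that of (Δ L)^k twelve times.
  small-root : ∀ {s q} k → 1 ≤ s → a ≤ b → b ≤ k * a → k * a ≤ 2 * b → s ^ k ≤ 2 ^ k * n →
    q ≤ n * s * ((Δ * L) ^ k) ^ 12 → q ^ b ≤ n ^ (b + 51 * a)
  small-root {s} {q} k 1≤s a≤b b≤ka ka≤2b rt q≤ = begin
    q ^ b                                   ≤⟨ ^-monoˡ-≤ b q≤ ⟩
    (n * s * M ^ 12) ^ b                    ≡⟨ ^-distribʳ-* (n * s) (M ^ 12) b ⟩
    (n * s) ^ b * (M ^ 12) ^ b              ≡⟨ cong₂ _*_ (^-distribʳ-* n s b) swap-powers ⟩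
    n ^ b * s ^ b * (M ^ b) ^ 12            ≤⟨ *-mono-≤ (*-monoʳ-≤ (n ^ b) (s^b≤n^3a k 1≤s a≤b b≤ka ka≤2b rt))
                                                 (^-monoˡ-≤ 12 (N^kb≤n^4a k ka≤2b)) ⟩
    n ^ b * n ^ (3 * a) * (n ^ (4 * a)) ^ 12  ≡⟨ cong (n ^ b * n ^ (3 * a) *_) (^-*-assoc n (4 * a) 12) ⟩
    n ^ b * n ^ (3 * a) * n ^ (4 * a * 12)  ≡⟨ cong (_* n ^ (4 * a * 12)) (^-distribˡ-+-* n b (3 * a)) ⟨
    n ^ (b + 3 * a) * n ^ (4 * a * 12)      ≡⟨ ^-distribˡ-+-* n (b + 3 * a) (4 * a * 12) ⟨
    n ^ (b + 3 * a + 4 * a * 12)            ≡⟨ cong (n ^_) (total a b) ⟩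
    n ^ (b + 51 * a)                        ∎
    where
    M = (Δ * L) ^ k
    swap-powers : (M ^ 12) ^ b ≡ (M ^ b) ^ 12
    swap-powers = trans (^-*-assoc M 12 b) (trans (cong (M ^_) (*-comm 12 b)) (sym (^-*-assoc M b 12)))
    total : ∀ a b → b + 3 * a + 4 * a * 12 ≡ b + 51 * a
    total = solve-∀

  -- If the root is at least 1, the claim allows n² queries, and the fuel already guarantees that.
  large-root : ∀ {q} → b ≤ a → q ≤ n * n → q ^ b ≤ n ^ (b + 51 * a)
  large-root {q} b≤a q≤ = begin
    q ^ b            ≤⟨ ^-monoˡ-≤ b q≤ ⟩
    (n * n) ^ b      ≡⟨ ^-distribʳ-* n n b ⟩
    n ^ b * n ^ b    ≡⟨ ^-distribˡ-+-* n b b ⟨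
    n ^ (b + b)      ≤⟨ ^-monoʳ-≤ n (+-monoʳ-≤ b (≤-trans b≤a (m≤m+n a (50 * a)))) ⟩
    n ^ (b + 51 * a) ∎

-- The query complexity

module _ {n : ℕ} (G : Graph n) where

  neighbours≤maxDegree : ∀ u → length (neighbours (edges G) u) ≤ maxDegree G
  neighbours≤maxDegree u = begin
    length (neighbours (edges G) u)  ≡⟨ trans (length-filter≡∑ (λ v → T? (edges G u v)) (allFin n)) (sym (∣tabulate∣≡∑ (edges G u))) ⟩
    degree G u                       ≤⟨ ≤max (tabulate (degree G)) (∈-tabulate⁺ {f = degree G} u) ⟩
    maxDegree G                      ∎
    where open ≤-Reasoning

  edge⇒1≤maxDegree : ∀ {u v} → Adj G u v → 1 ≤ maxDegree G
  edge⇒1≤maxDegree {u} {v} e =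
    ≤-trans (∈⇒1≤length (neighbours (edges G) u) v∈) (neighbours≤maxDegree u)
    where
    v∈ : v ∈ neighbours (edges G) u
    v∈ = ∈-filter⁺ (λ w → T? (edges G u w)) (∈-allFin v) e
    ∈⇒1≤length : ∀ {x : Fin n} xs → x ∈ xs → 1 ≤ length xs
    ∈⇒1≤length (_ ∷ _) _ = s≤s z≤n

  walk⇒1≤maxDegree : ∀ {u v} → u ≢ v → Star (Adj G) u v → 1 ≤ maxDegree G
  walk⇒1≤maxDegree u≢u ε       = contradiction refl u≢u
  walk⇒1≤maxDegree _   (e ◅ _) = edge⇒1≤maxDegree e

connected⇒1≤maxDegree : ∀ {n} (G : Graph n) → 2 ≤ n → Connected G → 1 ≤ maxDegree G
connected⇒1≤maxDegree {suc (suc _)} G _ conn =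
  walk⇒1≤maxDegree G {Fin.zero} {Fin.suc Fin.zero} (λ ()) (conn Fin.zero (Fin.suc Fin.zero))
connected⇒1≤maxDegree {suc zero} G (s≤s ()) conn

module _ {n : ℕ} {G : Graph n} (O : Oracle G) where
  open Analysis O
  open Performance O

  module _ (L : ℕ) (n<2^L : n < 2 ^ L) where

    queries-from-certificates : ∀ f .{{_ : NonZero f}} →
      (∀ X Z → Invariant X Z → Reachable X Z → ∃[ qs ] (length qs ≤ f × Certificate X qs)) →
      queries O (reconstruct n) ≤ n * maxDegree G + f * (2 * L)
    queries-from-certificates f certs = ≤-trans (reconstruct-queries f certs {2 * L} (square<2^ n L n<2^L))
      (+-monoˡ-≤ (f * (2 * L)) (count≤ (edges G) (neighbours≤maxDegree G)))

    treewidth-queries : (D : TreeDecomposition G) → Fin n → .{{_ : NonZero L}} →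
      queries O (reconstruct n) ≤
        n * maxDegree G + n * (L * (suc (width D) * suc (maxDegree G))) * (2 * L)
    treewidth-queries D v₀ = queries-from-certificates f {{f≢0}} certs
      where
      f = n * (L * (suc (width D) * suc (maxDegree G)))
      f≢0 : NonZero f
      f≢0 = m*n≢0 n _ {{nonZeroIndex v₀}} {{m*n≢0 L _}}
      t₀ : Fin (TreeDecomposition.nodes D)
      t₀ = proj₁ (TreeDecomposition.coversVertex D v₀)
      certs : ∀ X Z → Invariant X Z → Reachable X Z → ∃[ qs ] (length qs ≤ f × Certificate X qs)
      certs X Z I reach = TreeCertificate.certificate (known I (neighbours≤maxDegree G) reach) D
        (Invariant.sound I) t₀ L n<2^L

    general-queries : ∀ s k → 1 ≤ s → 1 ≤ maxDegree G → 2 ≤ L → n ≤ s ^ k →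
      queries O (reconstruct n) ≤
        n * maxDegree G + s ^ suc k * ((maxDegree G * L) ^ 8) ^ k * (2 * L)
    general-queries s k 1≤s 1≤Δ 2≤L n≤s^k = queries-from-certificates f {{f≢0}} certs
      where
      N R β f : ℕ
      N = maxDegree G * L
      R = N ^ 8
      β = s * (20 * (N * N))
      f = s ^ suc k * R ^ k
      2≤N : 2 ≤ N
      2≤N = *-mono-≤ 1≤Δ 2≤L
      1≤R : 1 ≤ R
      1≤R = 1≤^ 8 (≤-trans (s≤s z≤n) 2≤N)
      f≢0 : NonZero f
      f≢0 = >-nonZero (*-mono-≤ (1≤^ (suc k) 1≤s) (1≤^ k 1≤R))
      2β≤sR : 2 * β ≤ s * R
      2β≤sR = ≤-trans (≤-reflexive (double s (N * N))) (*-monoʳ-≤ s (40N²≤N⁸ 2≤N))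
        where
        double : ∀ s x → 2 * (s * (20 * x)) ≡ s * (40 * x)
        double = solve-∀
      certs : ∀ X Z → Invariant X Z → Reachable X Z → ∃[ qs ] (length qs ≤ f × Certificate X qs)
      certs X Z I reach =
        let qs , len , cert = GeneralCertificate.certificate (known I (neighbours≤maxDegree G) reach) s (2 * L) β
              (square<2^ n L n<2^L) (branching-bound 1≤s 1≤Δ (≤-trans (s≤s z≤n) 2≤L)) {{>-nonZero 1≤s}} k n≤s^k
        in qs , ≤-trans len (certificateSize≤ k 2β≤sR 1≤R) , cert

treewidth-bound : ∀ n → 2 ≤ n → (G : Graph n) → Connected G → (O : Oracle G) →
  (tw : ℕ) → HasTreewidth G tw → TreewidthBound 17 n (maxDegree G) tw (queries O (reconstruct n))
treewidth-bound n 2≤n G conn O _ ((D , refl) , _) c d _ logn =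
  let ℓ , lo , hi = log₂-bounds n (≤-trans (s≤s z≤n) 2≤n)
      Ld≤2c , d≤c = log₂-scaled {n} {c} {d} {ℓ} 2≤n logn lo
  in treewidth-arithmetic {n} {maxDegree G} {width D} {queries O (reconstruct n)} {c} {d} {suc ℓ}
       (connected⇒1≤maxDegree G 2≤n conn) Ld≤2c d≤c
       (treewidth-queries O (suc ℓ) hi D (Fin.fromℕ< 2≤n))

module _ {n : ℕ} (4≤n : 4 ≤ n) {G : Graph n} (1≤Δ : 1 ≤ maxDegree G) (O : Oracle G) {ℓ : ℕ} (n<2^L : n < 2 ^ suc ℓ) where

  2≤L : 2 ≤ suc ℓ
  2≤L = 2^-cancel-≤ {2} {suc ℓ} (≤-trans 4≤n (<⇒≤ n<2^L))

  general-bound-at : ∀ {a b c d} → NonZero b → NonZero d → Log₂≤ n c d → suc ℓ * d ≤ 2 * c →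
    (maxDegree G * c) ^ (b * b) ≤ n ^ (a * a) * d ^ (b * b) →
    queries O (reconstruct n) ^ b ≤ n ^ (b + 51 * a)
  general-bound-at {a} {b} {c} {d} b≢0 d≢0 logn Ld≤2c root = conclude (≤-total b a)
    where
    open RootBound {n} {maxDegree G} {a} {b} {c} {d} {suc ℓ} {{b≢0}} {{d≢0}} 4≤n 1≤Δ logn Ld≤2c root
    conclude : b ≤ a ⊎ a ≤ b → queries O (reconstruct n) ^ b ≤ n ^ (b + 51 * a)
    conclude (inj₁ b≤a) = large-root b≤a (Performance.reconstruct-queries≤n² O)
    conclude (inj₂ a≤b) =
      let k , b≤ka , ka≤2b = ratio-above a b {{a≢0}} a≤b
          s , n≤s^k , s^k≤ = root-above (suc k) n (≤-trans (s≤s z≤n) 4≤n)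
      in small-root {suc s} (suc k) (s≤s z≤n) a≤b b≤ka ka≤2b s^k≤
        (general-query-bound {n} {maxDegree G} {suc ℓ} {suc s} (suc k) (s≤s z≤n) 1≤Δ 2≤L s^k≤
          (general-queries O (suc ℓ) n<2^L (suc s) (suc k) (s≤s z≤n) 1≤Δ 2≤L n≤s^k))

general-bound : ∀ n → 4 ≤ n → (G : Graph n) → Connected G → (O : Oracle G) →
  GeneralBound 51 n (maxDegree G) (queries O (reconstruct n))
general-bound n 4≤n G conn O a b b≢0 (c , d , d≢0 , logn , root) =
  let 2≤n = ≤-trans (s≤s (s≤s z≤n)) 4≤n
      ℓ , lo , hi = log₂-bounds n (≤-trans (s≤s z≤n) 4≤n)
  in general-bound-at 4≤n (connected⇒1≤maxDegree G 2≤n conn) O {ℓ} hi {a} {b} {c} {d} b≢0 d≢0 logn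
       (proj₁ (log₂-scaled {n} {c} {d} {ℓ} 2≤n logn lo)) root

theorem2 : Σ[ A ∈ ((n : ℕ) → Algorithm n) ]
    ( (∀ (n : ℕ) (G : Graph n) → Connected G → (O : Oracle G) →
    ∀ u v → output O (A n) u v ≡ edges G u v)
    × (∃[ C ] ∃[ n₀ ] (∀ (n : ℕ) → n₀ ≤ n →
    (G : Graph n) → Connected G → (O : Oracle G) →
    GeneralBound C n (maxDegree G) (queries O (A n))))
    × (∃[ C ] ∃[ n₀ ] (∀ (n : ℕ) → n₀ ≤ n →
    (G : Graph n) → Connected G → (O : Oracle G) →
    (tw : ℕ) → HasTreewidth G tw →
    TreewidthBound C n (maxDegree G) tw (queries O (A n)))) )
theorem2 = reconstruct
  , (λ n G _ O → Performance.reconstruct-correct O)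
  , (51 , 4 , general-bound)
  , (17 , 2 , treewidth-bound)
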